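{- Let $G=(V,E)$ be a finite undirected edge-weighted multigraph with weights $w:E\to[0,1]$, whose edges are revealed one by one in an arbitrary order and must be colored irrevocably on arrival. Let $m$ be the maximum, over all vertices $v$, of the minimum number of unit-sized bins needed to pack the weights of all edges incident to $v$, and let $t$ be the maximum, over all vertices, of the number of (distinct) neighbors of the vertex. Then: (i) $1.693\cdot 2m+24t$ colors are sufficient for the HARMONIC$_{12}$ edge coloring algorithm to produce a proper weighted coloring of $G$ online, i.e. run with a palette of this many colors, the algorithm never fails to find a color for an arriving edge, and the coloring is proper at all times; (ii) $4m+2t$ colors are sufficient, in the same sense, for the NEXT-FIT edge coloring algorithm to produce a proper weighted coloring of $G$ online.
   Context: Multigraphs may have several edges between a pair of vertices (no loops). An edge coloring is a proper weighted coloring if, for every vertex $v$ and every color $c$, the sum of the weights of the edges incident to $v$ colored $c$ is at most $1$; in the online setting this must hold at every moment. The quantities $m$ and $t$ refer to the whole (final) graph $G$. A minimum packing into unit-sized bins partitions the items into the fewest groups each of total weight at most $1$. NEXT-FIT edge coloring algorithm. Colors are numbered $1,2,3,\dots$ in a palette. Between any two neighboring vertices there is exactly one open color at any time. A color is closed for a vertex if it was once the open color between that vertex and one of its neighbors and has since been closed; a color is empty for a vertex if it is neither open nor closed for that vertex. When an edge $e=(u,v)$ arrives: if it is the first edge between $u$ and $v$, the least-numbered color that is empty for both $u$ and $v$ becomes the open color between them and $e$ gets this color. Otherwise let $c$ be the current open color between $u$ and $v$; if $e$ can be colored $c$ without violating the proper weighted coloring condition, color $e$ with $c$; else close $c$ (closed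 colors are not used again at $u$ or $v$), let the least-numbered color $c'$ of the palette that is empty for both $u$ and $v$ become the open color between $u$ and $v$, and color $e$ with $c'$. HARMONIC$_{12}$ edge coloring algorithm. Each edge has a type in $\{1,\dots,12\}$ determined by its weight: type $i$ for $1\le i\le 11$ if the weight lies in $(1/(i+1),1/i]$, and type $12$ if the weight lies in $[0,1/12]$. The algorithm is identical to the one above, except that between any two neighboring vertices there is a separate open color for each type (introduced when the first edge of that type between them arrives), and an arriving edge of type $i$ between $u$ and $v$ is handled using only the open color of type $i$ between $u$ and $v$; new open colors are again the least-numbered palette colors that are empty (neither open of any type nor closed) for both $u$ and $v$. -}

module Defs where

open import Algebra.Bundles using (CommutativeRing)
import Algebra.Properties.Monoid.Mult as Mult
open import Data.Bool.Base using (if_then_else_)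
open import Data.Fin.Base using (Fin; toℕ; fromℕ; inject₁; zero)
open import Data.Fin.Properties using (any?; all?) renaming (_≟_ to _≟ᶠ_)
open import Data.List.Base using (List; []; _∷_; _++_; allFin; concat; filter; find; foldr; length; map)
open import Data.List.Membership.Propositional using (_∈_; _∉_)
import Data.List.Membership.DecPropositional as DecMembership
open import Data.List.Relation.Binary.Permutation.Propositional using (_↭_)
open import Data.List.Relation.Unary.Any using (Any) renaming (any? to anyₗ?)
open import Data.Maybe.Base as Maybe using (Maybe; just; nothing; maybe; _>>=_)
open import Data.Maybe.Properties using (≡-dec)
open import Data.Nat.Base as ℕ using (ℕ; suc; _⊔_)
open import Data.Product.Base using (Σ; ∃; _×_; _,_; proj₁)
open import Data.Sum.Base using (_⊎_)
open import Data.Vec.Base using (Vec; toList)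
open import Data.Vec.Relation.Unary.All using (All)
import Data.Vec.Functional as Vector
open import Level using () renaming (suc to lsuc; _⊔_ to _⊔ˡ_)
open import Relation.Binary.Core using (Rel)
import Relation.Binary.Construct.NonStrictToStrict as Strict
open import Relation.Binary.PropositionalEquality using (_≡_; _≢_)
open import Relation.Binary.Structures using (IsDecTotalOrder)
open import Relation.Nullary using (¬_; Dec; does; ¬?; _×-dec_; _⊎-dec_)

-- Edge weights live in an arbitrary ordered field; classically, the real
-- numbers are an instance.  As in many libraries the inverse is total, with an
-- unspecified value at 0#.
record OrderedField c ℓ₁ ℓ₂ : Set (lsuc (c ⊔ˡ ℓ₁ ⊔ˡ ℓ₂)) where
  infix  8 _⁻¹
  infix  4 _≤_
  field
    commutativeRing : CommutativeRing c ℓ₁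
  open CommutativeRing commutativeRing public
  field
    _≤_             : Rel Carrier ℓ₂
    isDecTotalOrder : IsDecTotalOrder _≈_ _≤_
    +-monoˡ-≤       : ∀ z {x y} → x ≤ y → x + z ≤ y + z
    *-nonNegative   : ∀ {x y} → 0# ≤ x → 0# ≤ y → 0# ≤ x * y
    0≉1             : ¬ 0# ≈ 1#
    _⁻¹             : Carrier → Carrier
    ⁻¹-inverseʳ     : ∀ {x} → ¬ x ≈ 0# → x * x ⁻¹ ≈ 1#

  open IsDecTotalOrder isDecTotalOrder public using (_≟_; _≤?_)
  open Strict _≈_ _≤_ public using (_<_)

  _<?_ : ∀ x y → Dec (x < y)
  _<?_ = Strict.<-decidable _≈_ _≤_ _≟_ _≤?_

  1/suc : ℕ → Carrier
  1/suc k = (suc k · 1#) ⁻¹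
    where open Mult +-monoid using () renaming (_×_ to _·_)

maximum : ∀ {n} → (Fin n → ℕ) → ℕ
maximum = Vector.foldr _⊔_ 0

module WeightedColoring {c ℓ₁ ℓ₂} (F : OrderedField c ℓ₁ ℓ₂) where

  open OrderedField F
    using (Carrier; 0#; 1#; _+_; _≤_; _≤?_; _<?_; 1/suc)

  -- The two endpoints of an edge are stored in some order, which carries no
  -- meaning: everything below treats edges as undirected.
  record Edge (n : ℕ) : Set (c ⊔ˡ ℓ₂) where
    field
      end₁ end₂ : Fin n
      loopless  : end₁ ≢ end₂
      weight    : Carrier
      0≤weight  : 0# ≤ weight
      weight≤1  : weight ≤ 1#
  open Edge public

  record Multigraph : Set (c ⊔ˡ ℓ₂) where
    field
      order : ℕ
      edges : List (Edge order)
  open Multigraph public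

  module _ {n : ℕ} where

    Incident : Fin n → Edge n → Set
    Incident v e = v ≡ end₁ e ⊎ v ≡ end₂ e

    incident? : ∀ v e → Dec (Incident v e)
    incident? v e = (v ≟ᶠ end₁ e) ⊎-dec (v ≟ᶠ end₂ e)

    Joins : Fin n → Fin n → Edge n → Set
    Joins u v e = (u ≡ end₁ e × v ≡ end₂ e) ⊎ (u ≡ end₂ e × v ≡ end₁ e)

    joins? : ∀ u v e → Dec (Joins u v e)
    joins? u v e = ((u ≟ᶠ end₁ e) ×-dec (v ≟ᶠ end₂ e))
             ⊎-dec ((u ≟ᶠ end₂ e) ×-dec (v ≟ᶠ end₁ e))

    totalWeight : List (Edge n) → Carrier
    totalWeight es = foldr _+_ 0# (map weight es)

    Packing : List (Edge n) → ℕ → Set (c ⊔ˡ ℓ₂)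
    Packing es k = Σ (Vec (List (Edge n)) k) λ bins →
      concat (toList bins) ↭ es × All (λ bin → totalWeight bin ≤ 1#) bins

    IsMinBins : List (Edge n) → ℕ → Set (c ⊔ˡ ℓ₂)
    IsMinBins es k = Packing es k × (∀ j → Packing es j → k ℕ.≤ j)

  IsMaxMinBins : Multigraph → ℕ → Set (c ⊔ˡ ℓ₂)
  IsMaxMinBins G m = Σ (Fin (order G) → ℕ) λ bins →
    (∀ v → IsMinBins (filter (incident? v) (edges G)) (bins v)) × m ≡ maximum bins

  neighbors : (G : Multigraph) → Fin (order G) → List (Fin (order G))
  neighbors G v = filter (λ u → anyₗ? (joins? v u) (edges G)) (allFin (order G))

  maxNeighbors : Multigraph → ℕ
  maxNeighbors G = maximum λ v → length (neighbors G v)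

  -- The color with index i is the (i+1)-st color of a palette of N colors.
  Coloring : ℕ → ℕ → Set (c ⊔ˡ ℓ₂)
  Coloring n N = List (Edge n × Fin N)

  module _ {n N : ℕ} where

    load : Coloring n N → Fin n → Fin N → Carrier
    load κ v a = totalWeight
      (map proj₁ (filter (λ (e , b) → incident? v e ×-dec (b ≟ᶠ a)) κ))

    Proper : Coloring n N → Set ℓ₂
    Proper κ = ∀ v a → load κ v a ≤ 1#

    proper? : ∀ κ → Dec (Proper κ)
    proper? κ = all? λ v → all? λ a → load κ v a ≤? 1#

  -- Both algorithms, parametrised by the classification of weights into K
  -- types: between two neighbors there is one open color per type.
  module Algorithm {K : ℕ} (type : Carrier → Fin K) (n N : ℕ) where

    open DecMembership (_≟ᶠ_ {N}) using (_∈?_)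

    record State : Set (c ⊔ˡ ℓ₂) where
      field
        coloring  : Coloring n N
        openColor : Fin n → Fin n → Fin K → Maybe (Fin N)
        closed    : Fin n → List (Fin N)
    open State public

    initial : State
    initial = record
      { coloring  = []
      ; openColor = λ _ _ _ → nothing
      ; closed    = λ _ → []
      }

    Empty : State → Fin n → Fin N → Set
    Empty s v a =
      (¬ ∃ λ u → ∃ λ τ → openColor s v u τ ≡ just a) × a ∉ closed s v

    empty? : ∀ s v a → Dec (Empty s v a)
    empty? s v a =
      ¬? (any? λ u → any? λ τ → ≡-dec _≟ᶠ_ (openColor s v u τ) (just a))
      ×-dec ¬? (a ∈? closed s v)

    -- The open color for the type and the endpoints of e becomes x.
    setOpen : Edge n → Maybe (Fin N) → State → State
    setOpen e x s = record s
      { openColor = λ u v τ →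
          if does (joins? u v e ×-dec (τ ≟ᶠ type (weight e)))
          then x else openColor s u v τ
      }

    close : Edge n → Fin N → State → State
    close e a s = record (setOpen e nothing s)
      { closed = λ v →
          if does (incident? v e) then a ∷ closed s v else closed s v
      }

    assign : Edge n → Fin N → State → State
    assign e a s = record s { coloring = (e , a) ∷ coloring s }

    -- `find` searches `allFin N` in increasing order, so it returns the
    -- least-numbered suitable color, or `nothing` if the palette has none.
    useNewColor : Edge n → State → Maybe State
    useNewColor e s = Maybe.map (λ a → assign e a (setOpen e (just a) s))
      (find (λ a → empty? s (end₁ e) a ×-dec empty? s (end₂ e) a) (allFin N))

    step : State → Edge n → Maybe State
    step s e with openColor s (end₁ e) (end₂ e) (type (weight e))
    ... | nothing = useNewColor e s
    ... | just a  = if does (proper? ((e , a) ∷ coloring s))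
                    then just (assign e a s)
                    else useNewColor e (close e a s)

    runFrom : State → List (Edge n) → Maybe State
    runFrom s []       = just s
    runFrom s (e ∷ es) = step s e >>= λ s′ → runFrom s′ es

    -- After every initial segment of the arrival sequence, the algorithm has
    -- not run out of colors and the coloring so far is proper.
    Succeeds : List (Edge n) → Set (c ⊔ˡ ℓ₂)
    Succeeds arrivals = ∀ before after → arrivals ≡ before ++ after →
      Σ State λ s → runFrom initial before ≡ just s × Proper (coloring s)

  module NextFit = Algorithm {1} (λ _ → zero)

  -- The index i stands for type i+1, whose interval is (1/(i+2), 1/(i+1)];
  -- weights in [0,1] outside the first eleven intervals lie in [0,1/12].
  harmonicType : Carrier → Fin 12
  harmonicType w = maybe inject₁ (fromℕ 11)
    (find (λ i → (1/suc (suc (toℕ i)) <? w) ×-dec (w ≤? 1/suc (toℕ i))) (allFin 11))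

  module Harmonic₁₂ = Algorithm harmonicType

-- A new color exists as soon as the closed and open colors at the two endpoints
-- number less than N.  With t neighbors and K types a vertex has fewer than K t
-- open colors when a color is missing, so the point is to bound the closed ones
-- by amortization: each edge e pays φ(e), and closing a color costs one unit,
-- for which the saved part ψ of the edges of that color must suffice.
-- For NEXT-FIT take φ = 2w and ψ = w: if e does not fit into a bin of weight B
-- then 1 + w(e) ≤ B + 2 w(e).  For HARMONIC take φ = ψ to be the classical
-- weights, for which a closed bin has weight at least 1.  The edges at a vertex
-- fit into m unit bins, so at most m · sup φ(bin) colors are closed there, where
-- the supremum over unit bins is 2 and 1 + 1/2 + 1/6 + 12/11 · 1/42 < 1.693.

module Submission where

open import Defs
import Algebra.Properties.CommutativeMonoid.Mult as CommutativeMonoidMult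
import Algebra.Properties.CommutativeSemigroup as CommutativeSemigroupProperties
import Algebra.Properties.Ring as RingProperties
import Algebra.Properties.Semiring.Mult as SemiringMult
open import Data.Bool.Base using (if_then_else_)
open import Data.Fin.Base using (Fin; zero; suc; toℕ; fromℕ; fromℕ<; inject₁)
open import Data.Fin.Properties
  using (pigeonhole; ¬∀⟶∃¬; <⇒≢; inject₁-injective; fromℕ≢inject₁; toℕ-fromℕ<)
  renaming (_≟_ to _≟ᶠ_; all? to allFin?)
open import Data.List.Base
  using (List; []; _∷_; _++_; allFin; cartesianProduct; concat; filter; find; foldr; length; map; mapMaybe)
open import Data.List.Membership.Propositional using (_∈_; _∉_; lose)
open import Data.List.Membership.Propositional.Properties
  using (∈-allFin; ∈-++⁺ˡ; ∈-++⁺ʳ; ∈-filter⁺; ∈-filter⁻; ∈-cartesianProduct⁺; ∈-map⁻)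
import Data.List.Membership.DecPropositional as DecMembership
import Data.List.Membership.Setoid.Properties as SetoidMembership
open import Data.List.Properties
  using (length-++; length-map; length-mapMaybe; length-tabulate;
         filter-accept; filter-reject; filter-++; filter-none)
open import Data.List.Relation.Binary.Permutation.Propositional as ↭
  using (_↭_; prep; ↭-sym; ↭⇒↭ₛ; ↭ₛ⇒↭)
open import Data.List.Relation.Binary.Permutation.Propositional.Properties using (shift; ∈-resp-↭)
import Data.List.Relation.Binary.Permutation.Setoid.Properties as SetoidPermutation
open import Data.List.Relation.Unary.All as All using (All; []; _∷_)
open import Data.List.Relation.Unary.Any as Any using (Any; here; there)
open import Data.Maybe.Base as Maybe using (Maybe; just; nothing; maybe)
open import Data.Nat.Base as ℕ using (ℕ; zero; suc; s≤s; _/_)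
open import Data.Nat.DivMod using (m*n/n≡m; /-monoˡ-≤)
import Data.Nat.Properties as ℕ
open import Data.Nat.Solver using (module +-*-Solver)
open import Data.Product.Base using (∃; ∃₂; _×_; _,_; proj₁; proj₂; swap)
open import Data.Sum.Base as Sum using (_⊎_; inj₁; inj₂; [_,_]′)
open import Data.Vec.Base using (Vec; []; _∷_; toList)
import Data.Vec.Relation.Unary.All as Vec
open import Function.Base using (_∘_; id)
import Level
open import Relation.Binary.Bundles using (Poset)
import Relation.Binary.Construct.NonStrictToStrict as Strict
open import Relation.Binary.PropositionalEquality as ≡ using (_≡_)
open import Relation.Binary.Structures using (IsDecTotalOrder)
open import Relation.Nullary using (¬_; Dec; does; yes; no; contradiction; ¬?; _×-dec_)
open import Relation.Nullary.Decidable using (from-yes)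
open import Relation.Unary using (Pred; Decidable)

-- Ordered fields and finite sums

-- Closing a color costs a unit at both ends of the edge, and each end keeps its own books: the
-- edges at `u` must pay without help from `v`. This works because, while a color is open between
-- `u` and `v` for one type, every edge at `u` or `v` that bears it joins `u` and `v` and has that
-- type. The bin seen from `u` is the bin seen from `v`, and an overflow at one end is an overflow
-- at both. The edge `e` that forces the closing becomes the first edge of the next bin, so its `ψ`
-- must stay reserved. In NEXT-FIT `e` may be needed to fill the old bin up to a unit, hence
-- `φ = 2w`: one `w` for the closed bin, one kept for the next. In HARMONIC the closed bin is worth
-- a unit without `e`, hence `φ = ψ`. Colors are sought in mid-run, whereas `m` and `t` belong to
-- the final graph; nonnegativity of `φ` bridges the gap. Beyond the definition of the types,
-- fractions are multiplied out to natural multiples, so that the count of closed colors can be read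
-- off in the natural numbers.

module OrderedFieldProperties {c ℓ₁ ℓ₂} (F : OrderedField c ℓ₁ ℓ₂) where

  open OrderedField F
  open IsDecTotalOrder isDecTotalOrder public
    using (total; antisym; ≤-respˡ-≈; ≤-respʳ-≈; isPartialOrder)
    renaming (refl to ≤-refl; reflexive to ≤-reflexive; trans to ≤-trans)
  open CommutativeSemigroupProperties +-commutativeSemigroup using (x∙yz≈y∙xz)
  open RingProperties ring using (-‿distribˡ-*; -‿involutive)
  open CommutativeMonoidMult +-commutativeMonoid using (×-distrib-+; ×-congʳ; ×-homo-+; ×-assocˡ; ×-homo-1)
  open SemiringMult semiring using (×-assoc-*)

  poset : Poset c ℓ₁ ℓ₂
  poset = record { isPartialOrder = isPartialOrder }

  open import Relation.Binary.Reasoning.PartialOrder poset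

  ≰⇒> : ∀ {x y} → ¬ x ≤ y → y < x
  ≰⇒> = Strict.≰⇒> _≈_ _≤_ sym ≤-reflexive total

  ≮⇒≥ : ∀ {x y} → ¬ x < y → y ≤ x
  ≮⇒≥ = Strict.≮⇒≥ _≈_ _≤_ sym _≟_ ≤-reflexive total

  <⇒≱ : ∀ {x y} → x < y → ¬ y ≤ x
  <⇒≱ = Strict.<⇒≱ _≈_ _≤_ antisym

  +-monoʳ-≤ : ∀ z {x y} → x ≤ y → z + x ≤ z + y
  +-monoʳ-≤ z {x} {y} x≤y = begin
    z + x  ≈⟨ +-comm z x ⟩
    x + z  ≤⟨ +-monoˡ-≤ z x≤y ⟩
    y + z  ≈⟨ +-comm y z ⟩
    z + y  ∎

  +-mono-≤ : ∀ {w x y z} → w ≤ x → y ≤ z → w + y ≤ x + z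
  +-mono-≤ {_} {x} {y} w≤x y≤z = ≤-trans (+-monoˡ-≤ y w≤x) (+-monoʳ-≤ x y≤z)

  +-cancelʳ-≤ : ∀ z {x y} → x + z ≤ y + z → x ≤ y
  +-cancelʳ-≤ z {x} {y} x+z≤y+z = begin
    x              ≈⟨ undo x ⟨
    x + z + - z    ≤⟨ +-monoˡ-≤ (- z) x+z≤y+z ⟩
    y + z + - z    ≈⟨ undo y ⟩
    y              ∎
    where
    undo : ∀ w → w + z + - z ≈ w
    undo w = begin-equality
      w + z + - z    ≈⟨ +-assoc w z (- z) ⟩
      w + (z + - z)  ≈⟨ +-congˡ (-‿inverseʳ z) ⟩
      w + 0#         ≈⟨ +-identityʳ w ⟩
      w              ∎

  +-cancelˡ-≤ : ∀ z {x y} → z + x ≤ z + y → x ≤ y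
  +-cancelˡ-≤ z {x} {y} z+x≤z+y = +-cancelʳ-≤ z (begin
    x + z  ≈⟨ +-comm x z ⟩
    z + x  ≤⟨ z+x≤z+y ⟩
    z + y  ≈⟨ +-comm z y ⟩
    y + z  ∎)

  +-mono-<-≤ : ∀ {w x y z} → w < x → y ≤ z → w + y < x + z
  +-mono-<-≤ {w} {x} {y} {z} w<x y≤z = ≰⇒> λ x+z≤w+y → <⇒≱ w<x (+-cancelʳ-≤ y (begin
    x + y  ≤⟨ +-monoʳ-≤ x y≤z ⟩
    x + z  ≤⟨ x+z≤w+y ⟩
    w + y  ∎))

  x≤y+x : ∀ {x y} → 0# ≤ y → x ≤ y + x
  x≤y+x {x} {y} 0≤y = begin
    x       ≈⟨ +-identityˡ x ⟨
    0# + x  ≤⟨ +-monoˡ-≤ x 0≤y ⟩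
    y + x   ∎

  x≤x+y : ∀ {x y} → 0# ≤ y → x ≤ x + y
  x≤x+y {x} {y} 0≤y = ≤-respʳ-≈ (+-comm y x) (x≤y+x 0≤y)

  +-nonNegative : ∀ {x y} → 0# ≤ x → 0# ≤ y → 0# ≤ x + y
  +-nonNegative 0≤x 0≤y = ≤-trans 0≤y (x≤y+x 0≤x)

  0≤1 : 0# ≤ 1#
  0≤1 = [ (λ h → h) , square ]′ (total 0# 1#)
    where
    square : 1# ≤ 0# → 0# ≤ 1#
    square 1≤0 = begin
      0#              ≤⟨ *-nonNegative 0≤-1 0≤-1 ⟩
      - 1# * - 1#     ≈⟨ -‿distribˡ-* 1# (- 1#) ⟨
      - (1# * - 1#)   ≈⟨ -‿cong (*-identityˡ (- 1#)) ⟩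
      - - 1#          ≈⟨ -‿involutive 1# ⟩
      1#              ∎
      where
      0≤-1 : 0# ≤ - 1#
      0≤-1 = begin
        0#         ≈⟨ -‿inverseʳ 1# ⟨
        1# + - 1#  ≤⟨ +-monoˡ-≤ (- 1#) 1≤0 ⟩
        0# + - 1#  ≈⟨ +-identityˡ (- 1#) ⟩
        - 1#       ∎

  0<1 : 0# < 1#
  0<1 = 0≤1 , 0≉1

  infixr 8 _·_

  -- Opaque, so that numerals such as 27720 · x are never unfolded.
  opaque
    _·_ : ℕ → Carrier → Carrier
    n · x = CommutativeMonoidMult._×_ +-commutativeMonoid n x

    0·x : ∀ x → 0 · x ≈ 0#
    0·x x = refl

    suc· : ∀ n x → suc n · x ≈ x + n · x
    suc· n x = refl

    1·x : ∀ x → 1 · x ≈ x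
    1·x = ×-homo-1

    ·-congˡ : ∀ n {x y} → x ≈ y → n · x ≈ n · y
    ·-congˡ n = ×-congʳ n

    ·-distribˡ : ∀ n x y → n · (x + y) ≈ n · x + n · y
    ·-distribˡ n x y = ×-distrib-+ x y n

    ·-distribʳ : ∀ x m n → (m ℕ.+ n) · x ≈ m · x + n · x
    ·-distribʳ = ×-homo-+

    ·-assoc : ∀ x m n → m · (n · x) ≈ (m ℕ.* n) · x
    ·-assoc = ×-assocˡ

    -- The inverse is meaningful only away from zero, and the order forces characteristic zero:
    -- `suc k · 1#` is at least `1#`.
    suc·1/suc : ∀ k → suc k · 1/suc k ≈ 1#
    suc·1/suc k = begin-equality
      suc k · r          ≈⟨ ×-congʳ (suc k) (*-identityˡ r) ⟨
      suc k · (1# * r)   ≈⟨ ×-assoc-* (suc k) 1# r ⟨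
      (suc k · 1#) * r   ≈⟨ ⁻¹-inverseʳ nonZero ⟩
      1#                 ∎
      where
      r : Carrier
      r = 1/suc k

      nonNegative : ∀ j → 0# ≤ j · 1#
      nonNegative zero    = ≤-refl
      nonNegative (suc j) = +-nonNegative 0≤1 (nonNegative j)

      nonZero : ¬ suc k · 1# ≈ 0#
      nonZero eq = <⇒≱ 0<1 (≤-trans (x≤x+y (nonNegative k)) (≤-reflexive eq))

  ·-nonNegative : ∀ n {x} → 0# ≤ x → 0# ≤ n · x
  ·-nonNegative zero    {x} 0≤x = ≤-reflexive (sym (0·x x))
  ·-nonNegative (suc n) {x} 0≤x =
    ≤-respʳ-≈ (sym (suc· n x)) (+-nonNegative 0≤x (·-nonNegative n 0≤x))

  ·-monoʳ-≤ : ∀ n {x y} → x ≤ y → n · x ≤ n · y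
  ·-monoʳ-≤ zero    {x} {y} x≤y = ≤-reflexive (trans (0·x x) (sym (0·x y)))
  ·-monoʳ-≤ (suc n) {x} {y} x≤y = begin
    suc n · x  ≈⟨ suc· n x ⟩
    x + n · x  ≤⟨ +-mono-≤ x≤y (·-monoʳ-≤ n x≤y) ⟩
    y + n · y  ≈⟨ suc· n y ⟨
    suc n · y  ∎

  ·-monoʳ-< : ∀ n {x y} → x < y → suc n · x < suc n · y
  ·-monoʳ-< n {x} {y} x<y = begin-strict
    suc n · x  ≈⟨ suc· n x ⟩
    x + n · x  <⟨ +-mono-<-≤ x<y (·-monoʳ-≤ n (proj₁ x<y)) ⟩
    y + n · y  ≈⟨ suc· n y ⟨
    suc n · y  ∎

  ·-monoˡ-≤ : ∀ {m n x} → 0# ≤ x → m ℕ.≤ n → m · x ≤ n · x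
  ·-monoˡ-≤ {m} {n} {x} 0≤x m≤n with k , ≡.refl ← ℕ.m≤n⇒∃[o]m+o≡n m≤n = begin
    m · x          ≤⟨ x≤x+y (·-nonNegative k 0≤x) ⟩
    m · x + k · x  ≈⟨ ·-distribʳ x m k ⟨
    (m ℕ.+ k) · x  ∎

  ·-cancelˡ-≤ : ∀ n {x y} → suc n · x ≤ suc n · y → x ≤ y
  ·-cancelˡ-≤ n nx≤ny = ≮⇒≥ λ y<x → <⇒≱ (·-monoʳ-< n y<x) nx≤ny

  -- The way back from the field to the natural numbers, used once the payments have been bounded.
  ·1-cancel-≤ : ∀ {m n} → m · 1# ≤ n · 1# → m ℕ.≤ n
  ·1-cancel-≤ {m} {n} m≤n with m ℕ.≤? n
  ... | yes p = p
  ... | no  p = contradiction m≤n (<⇒≱ (begin-strict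
    n · 1#          ≈⟨ +-identityˡ (n · 1#) ⟨
    0# + n · 1#     <⟨ +-mono-<-≤ 0<1 ≤-refl ⟩
    1# + n · 1#     ≈⟨ suc· n 1# ⟨
    suc n · 1#      ≤⟨ ·-monoˡ-≤ 0≤1 (ℕ.≰⇒> p) ⟩
    m · 1#          ∎))

  -- Clears denominators: from here on a bound by `1/k` is carried as a bound on `k · x`.
  ≤1/suc⇒ : ∀ k {x} → x ≤ 1/suc k → suc k · x ≤ 1#
  ≤1/suc⇒ k x≤ = ≤-respʳ-≈ (suc·1/suc k) (·-monoʳ-≤ (suc k) x≤)

  1/suc<⇒ : ∀ k {x} → 1/suc k < x → 1# < suc k · x
  1/suc<⇒ k {x} <x = begin-strict
    1#              ≈⟨ suc·1/suc k ⟨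
    suc k · 1/suc k <⟨ ·-monoʳ-< k <x ⟩
    suc k · x       ∎

  module _ {a} {A : Set a} where

    ∑ : (A → Carrier) → List A → Carrier
    ∑ f xs = foldr _+_ 0# (map f xs)

    ∑-nonNegative : ∀ {f : A → Carrier} → (∀ x → 0# ≤ f x) → ∀ xs → 0# ≤ ∑ f xs
    ∑-nonNegative 0≤f []       = ≤-refl
    ∑-nonNegative 0≤f (x ∷ xs) = +-nonNegative (0≤f x) (∑-nonNegative 0≤f xs)

    ∑-++ : ∀ (f : A → Carrier) xs ys → ∑ f (xs ++ ys) ≈ ∑ f xs + ∑ f ys
    ∑-++ f []       ys = sym (+-identityˡ _)
    ∑-++ f (x ∷ xs) ys = begin-equality
      f x + ∑ f (xs ++ ys)       ≈⟨ +-congˡ (∑-++ f xs ys) ⟩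
      f x + (∑ f xs + ∑ f ys)    ≈⟨ +-assoc (f x) (∑ f xs) (∑ f ys) ⟨
      f x + ∑ f xs + ∑ f ys      ∎

    ∑-↭ : ∀ (f : A → Carrier) {xs ys} → xs ↭ ys → ∑ f xs ≈ ∑ f ys
    ∑-↭ f ↭.refl           = begin-equality _ ∎
    ∑-↭ f (prep x p)     = +-congˡ (∑-↭ f p)
    ∑-↭ f (↭.swap {xs = xs} {ys = ys} x y p) = begin-equality
      f x + (f y + ∑ f xs)  ≈⟨ x∙yz≈y∙xz (f x) (f y) (∑ f xs) ⟩
      f y + (f x + ∑ f xs)  ≈⟨ +-congˡ (+-congˡ (∑-↭ f p)) ⟩
      f y + (f x + ∑ f ys)  ∎
    ∑-↭ f (↭.trans {xs} {ys} {zs} p q)    = begin-equality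
      ∑ f xs ≈⟨ ∑-↭ f p ⟩
      ∑ f ys ≈⟨ ∑-↭ f q ⟩
      ∑ f zs ∎

    -- The pair `m`, `n` stands for the rational ratio `n/m` between `f` and `g`.
    ∑-scaled : ∀ (f g : A → Carrier) m n {xs} → All (λ x → m · f x ≤ n · g x) xs →
               m · ∑ f xs ≤ n · ∑ g xs
    ∑-scaled f g m n []                  = begin
      m · 0#    ≤⟨ zeroes m ⟩
      0#        ≤⟨ ·-nonNegative n ≤-refl ⟩
      n · 0#    ∎
      where
      zeroes : ∀ k → k · 0# ≤ 0#
      zeroes zero    = ≤-reflexive (0·x 0#)
      zeroes (suc k) = begin
        suc k · 0#   ≈⟨ suc· k 0# ⟩
        0# + k · 0#  ≈⟨ +-identityˡ (k · 0#) ⟩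
        k · 0#       ≤⟨ zeroes k ⟩
        0#           ∎
    ∑-scaled f g m n {x ∷ xs} (px ∷ pxs) = begin
      m · (f x + ∑ f xs)      ≈⟨ ·-distribˡ m (f x) (∑ f xs) ⟩
      m · f x + m · ∑ f xs    ≤⟨ +-mono-≤ px (∑-scaled f g m n pxs) ⟩
      n · g x + n · ∑ g xs    ≈⟨ ·-distribˡ n (g x) (∑ g xs) ⟨
      n · (g x + ∑ g xs)      ∎

    ∑-replicated : ∀ {f : A → Carrier} {y xs} → All (λ x → f x ≡ y) xs → ∑ f xs ≈ length xs · y
    ∑-replicated {f} {y} {[]}     []                = sym (0·x y)
    ∑-replicated {f} {y} {x ∷ xs} (≡.refl ∷ pxs) = begin-equality
      f x + ∑ f xs          ≈⟨ +-congˡ (∑-replicated pxs) ⟩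
      f x + length xs · f x ≈⟨ suc· (length xs) (f x) ⟨
      suc (length xs) · f x ∎

    ∑-split : ∀ {p q r} {P : Pred A p} {Q : Pred A q} {R : Pred A r}
              (P? : Decidable P) (Q? : Decidable Q) (R? : Decidable R) →
              (∀ x → P x → Q x ⊎ R x) → (∀ x → Q x → P x) → (∀ x → R x → P x) →
              (∀ x → Q x → ¬ R x) → ∀ (f : A → Carrier) xs →
              ∑ f (filter P? xs) ≈ ∑ f (filter Q? xs) + ∑ f (filter R? xs)
    ∑-split P? Q? R? P⇒ Q⇒ R⇒ disjoint f = go
      where
      go : ∀ xs → ∑ f (filter P? xs) ≈ ∑ f (filter Q? xs) + ∑ f (filter R? xs)
      go []       = sym (+-identityˡ 0#)
      go (x ∷ xs) with P? x | Q? x | R? x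
      ... | yes p | yes q | yes r = contradiction r (disjoint x q)
      ... | yes p | yes q | no ¬r = begin-equality
        f x + ∑ f (filter P? xs)                               ≈⟨ +-congˡ (go xs) ⟩
        f x + (∑ f (filter Q? xs) + ∑ f (filter R? xs))        ≈⟨ +-assoc (f x) _ _ ⟨
        f x + ∑ f (filter Q? xs) + ∑ f (filter R? xs)          ∎
      ... | yes p | no ¬q | yes r = begin-equality
        f x + ∑ f (filter P? xs)                               ≈⟨ +-congˡ (go xs) ⟩
        f x + (∑ f (filter Q? xs) + ∑ f (filter R? xs))        ≈⟨ x∙yz≈y∙xz (f x) _ _ ⟩
        ∑ f (filter Q? xs) + (f x + ∑ f (filter R? xs))        ∎
      ... | yes p | no ¬q | no ¬r = contradiction (P⇒ x p) [ ¬q , ¬r ]′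
      ... | no ¬p | yes q | _     = contradiction (Q⇒ x q) ¬p
      ... | no ¬p | no ¬q | yes r = contradiction (R⇒ x r) ¬p
      ... | no ¬p | no ¬q | no ¬r = go xs

    partitionOne : ∀ {p} {P : Pred A p} → Decidable P → ∀ xs →
                   All (λ x → ¬ P x) xs ⊎ ∃₂ λ x ys → P x × x ∷ ys ↭ xs
    partitionOne P? []       = inj₁ []
    partitionOne P? (x ∷ xs) with P? x | partitionOne P? xs
    ... | yes p | _                         = inj₂ (x , xs , p , ↭.refl)
    ... | no ¬p | inj₁ none                 = inj₁ (¬p ∷ none)
    ... | no ¬p | inj₂ (y , ys , p , y∷ys↭) =
      inj₂ (y , x ∷ ys , p , ↭.trans (↭.swap y x ↭.refl) (prep x y∷ys↭))

-- Rounding, lists and the pigeonhole principle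

-- Here `k/D` bounds what a unit bin can pay, in units, and `r/d` is a rounder upper bound for it.
-- The integer `p + q` is at most `2m · r/d`, hence at most its floor.
sum-≤-quotient : ∀ r d D k p q m .{{_ : ℕ.NonZero d}} .{{_ : ℕ.NonZero D}} → k ℕ.* d ℕ.≤ r ℕ.* D →
                 p ℕ.* D ℕ.≤ m ℕ.* k → q ℕ.* D ℕ.≤ m ℕ.* k → p ℕ.+ q ℕ.≤ (r ℕ.* (2 ℕ.* m)) / d
sum-≤-quotient r d D k p q m kd≤rD pD≤ qD≤ = begin
  p ℕ.+ q                        ≡⟨ m*n/n≡m (p ℕ.+ q) d ⟨
  (p ℕ.+ q) ℕ.* d / d            ≤⟨ /-monoˡ-≤ d (ℕ.*-cancelʳ-≤ _ _ D scaled) ⟩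
  (r ℕ.* (2 ℕ.* m)) / d          ∎
  where
  open ℕ.≤-Reasoning
  open +-*-Solver
  scaled : (p ℕ.+ q) ℕ.* d ℕ.* D ℕ.≤ r ℕ.* (2 ℕ.* m) ℕ.* D
  scaled = begin
    (p ℕ.+ q) ℕ.* d ℕ.* D                  ≡⟨ solve 4 (λ p q d D → (p :+ q) :* d :* D := (p :* D :+ q :* D) :* d)
                                                ≡.refl p q d D ⟩
    (p ℕ.* D ℕ.+ q ℕ.* D) ℕ.* d            ≤⟨ ℕ.*-monoˡ-≤ d (ℕ.+-mono-≤ pD≤ qD≤) ⟩
    (m ℕ.* k ℕ.+ m ℕ.* k) ℕ.* d            ≡⟨ solve 3 (λ m k d → (m :* k :+ m :* k) :* d := con 2 :* m :* (k :* d))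
                                                ≡.refl m k d ⟩
    2 ℕ.* m ℕ.* (k ℕ.* d)                  ≤⟨ ℕ.*-monoʳ-≤ (2 ℕ.* m) kd≤rD ⟩
    2 ℕ.* m ℕ.* (r ℕ.* D)                  ≡⟨ solve 3 (λ m r D → con 2 :* m :* (r :* D) := r :* (con 2 :* m) :* D)
                                                ≡.refl m r D ⟩
    r ℕ.* (2 ℕ.* m) ℕ.* D                  ∎

module _ {a} {A : Set a} where

  if-cases : ∀ {p} {P : Set p} (P? : Dec P) (x y : A) →
             (P × (if does P? then x else y) ≡ x) ⊎ (¬ P × (if does P? then x else y) ≡ y)
  if-cases (yes p) x y = inj₁ (p , ≡.refl)
  if-cases (no ¬p) x y = inj₂ (¬p , ≡.refl)

  find-succeeds : ∀ {p} {P : Pred A p} (P? : Decidable P) {x} xs → x ∈ xs → P x →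
                  ∃ λ y → find P? xs ≡ just y × P y
  find-succeeds P? (x ∷ xs) x∈xs p with P? x | x∈xs
  ... | yes px | _             = x , ≡.refl , px
  ... | no ¬px | here ≡.refl   = contradiction p ¬px
  ... | no ¬px | there x∈xs′   = find-succeeds P? xs x∈xs′ p

  filter-cong-∈ : ∀ {p q} {P : Pred A p} {Q : Pred A q} (P? : Decidable P) (Q? : Decidable Q) xs →
                  (∀ {x} → x ∈ xs → (P x → Q x) × (Q x → P x)) → filter P? xs ≡ filter Q? xs
  filter-cong-∈ P? Q? []       P⇔Q = ≡.refl
  filter-cong-∈ P? Q? (x ∷ xs) P⇔Q with P? x | Q? x
  ... | yes p | yes q = ≡.cong (x ∷_) (filter-cong-∈ P? Q? xs (P⇔Q ∘ there))
  ... | yes p | no ¬q = contradiction (proj₁ (P⇔Q (here ≡.refl)) p) ¬q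
  ... | no ¬p | yes q = contradiction (proj₂ (P⇔Q (here ≡.refl)) q) ¬p
  ... | no ¬p | no ¬q = filter-cong-∈ P? Q? xs (P⇔Q ∘ there)

  filter-↭ : ∀ {p} {P : Pred A p} (P? : Decidable P) {xs ys} → xs ↭ ys → filter P? xs ↭ filter P? ys
  filter-↭ {P = P} P? = ↭ₛ⇒↭ ∘ SetoidPermutation.filter⁺ (≡.setoid A) P? (≡.subst P) ∘ ↭⇒↭ₛ

  module _ {b} {B : Set b} (f : A → Maybe B) where

    ∈-mapMaybe⁺ : ∀ {x y} xs → x ∈ xs → f x ≡ just y → y ∈ mapMaybe f xs
    ∈-mapMaybe⁺ (x ∷ xs) (here ≡.refl) eq with f x
    ∈-mapMaybe⁺ (x ∷ xs) (here ≡.refl) ≡.refl | just _ = here ≡.refl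
    ∈-mapMaybe⁺ (x ∷ xs) (there x∈xs)  eq with f x
    ... | just _  = there (∈-mapMaybe⁺ xs x∈xs eq)
    ... | nothing = ∈-mapMaybe⁺ xs x∈xs eq

    -- Source of the strict inequality in the count of open colors: the slot waiting for a color is
    -- the `nothing`.
    length-mapMaybe-< : ∀ {x} xs → x ∈ xs → f x ≡ nothing → length (mapMaybe f xs) ℕ.< length xs
    length-mapMaybe-< (x ∷ xs) (here ≡.refl) eq with f x
    ... | nothing = s≤s (length-mapMaybe f xs)
    length-mapMaybe-< (x ∷ xs) (there x∈xs)  eq with f x
    ... | just _  = s≤s (length-mapMaybe-< xs x∈xs eq)
    ... | nothing = ℕ.m≤n⇒m≤1+n (length-mapMaybe-< xs x∈xs eq)

length-cartesianProduct : ∀ {a b} {A : Set a} {B : Set b} (xs : List A) (ys : List B) →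
                          length (cartesianProduct xs ys) ≡ length xs ℕ.* length ys
length-cartesianProduct []       ys = ≡.refl
length-cartesianProduct (x ∷ xs) ys = ≡.trans (length-++ (map (x ,_) ys))
  (≡.cong₂ ℕ._+_ (length-map (x ,_) ys) (length-cartesianProduct xs ys))

-- If every color were listed, its position would inject `Fin N` into fewer than `N` positions.
∃∉ : ∀ {N} (xs : List (Fin N)) → length xs ℕ.< N → ∃ λ a → a ∉ xs
∃∉ {N} xs length<N = ¬∀⟶∃¬ N (_∈ xs) (_∈? xs) notAll
  where
  open DecMembership (_≟ᶠ_ {N}) using (_∈?_)
  notAll : ¬ (∀ a → a ∈ xs)
  notAll all with i , j , i<j , eq ← pigeonhole length<N (λ a → Any.index (all a)) =
    <⇒≢ i<j (SetoidMembership.index-injective (≡.setoid (Fin N)) (all i) (all j) eq)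

-- States reachable by the algorithms

module Run
  {c ℓ₁ ℓ₂} (F : OrderedField c ℓ₁ ℓ₂) (G : WeightedColoring.Multigraph F)
  {K : ℕ} (type : OrderedField.Carrier F → Fin K) (N : ℕ)
  where

  open OrderedField F
  open OrderedFieldProperties F
  open WeightedColoring F
  open Algorithm type (order G) N
  open DecMembership (_≟ᶠ_ {N}) using (_∈?_)

  Vertex : Set
  Vertex = Fin (order G)

  E : Set _
  E = Edge (order G)

  typeOf : E → Fin K
  typeOf e = type (weight e)

  joins-ends : ∀ (e : E) → Joins (end₁ e) (end₂ e) e
  joins-ends e = inj₁ (≡.refl , ≡.refl)

  joins-sym : ∀ {u v} {e : E} → Joins u v e → Joins v u e
  joins-sym = Sum.swap ∘ Sum.map swap swap

  joins⇒incident : ∀ {u v} {e : E} → Joins u v e → Incident u e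
  joins⇒incident = Sum.map proj₁ proj₁

  joins-functional : ∀ {u v v′} {e : E} → Joins u v e → Joins u v′ e → v ≡ v′
  joins-functional         (inj₁ (_ , p)) (inj₁ (_ , q)) = ≡.trans p (≡.sym q)
  joins-functional {e = e} (inj₁ (p , _)) (inj₂ (q , _)) = contradiction (≡.trans (≡.sym p) q) (loopless e)
  joins-functional {e = e} (inj₂ (p , _)) (inj₁ (q , _)) = contradiction (≡.trans (≡.sym q) p) (loopless e)
  joins-functional         (inj₂ (_ , p)) (inj₂ (_ , q)) = ≡.trans p (≡.sym q)

  incident⇒joins : ∀ {u} (e : E) → Incident u e → ∃ λ v → Joins u v e
  incident⇒joins e (inj₁ p) = end₂ e , inj₁ (p , ≡.refl)
  incident⇒joins e (inj₂ p) = end₁ e , inj₂ (p , ≡.refl)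

  Slot : Vertex → Vertex → Fin K → E → Set
  Slot u v τ e = Joins u v e × τ ≡ typeOf e

  setOpen-cases : ∀ e x s u v τ →
    (Slot u v τ e × openColor (setOpen e x s) u v τ ≡ x)
    ⊎ (¬ Slot u v τ e × openColor (setOpen e x s) u v τ ≡ openColor s u v τ)
  setOpen-cases e x s u v τ = if-cases (joins? u v e ×-dec (τ ≟ᶠ typeOf e)) x (openColor s u v τ)

  close-cases : ∀ e a s v →
    (Incident v e × closed (close e a s) v ≡ a ∷ closed s v)
    ⊎ (¬ Incident v e × closed (close e a s) v ≡ closed s v)
  close-cases e a s v = if-cases (incident? v e) (a ∷ closed s v) (closed s v)

  OpenFor : State → E → Maybe (Fin N) → Set
  OpenFor s e x = openColor s (end₁ e) (end₂ e) (typeOf e) ≡ x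

  colorClass? : ∀ v a → Decidable (λ ((e , b) : E × Fin N) → Incident v e × b ≡ a)
  colorClass? v a (e , b) = incident? v e ×-dec (b ≟ᶠ a)

  -- The bin behind a load: `load κ v a` is `totalWeight (colorClass κ v a)` by definition.
  colorClass : Coloring (order G) N → Vertex → Fin N → List E
  colorClass κ v a = map proj₁ (filter (colorClass? v a) κ)

  -- Only the loads of color `a` at the ends of `e` change.
  proper-∷ : ∀ {κ e a} → Proper κ →
             (∀ {v} → Incident v e → totalWeight (e ∷ colorClass κ v a) ≤ 1#) →
             Proper ((e , a) ∷ κ)
  proper-∷ {κ} {e} {a} proper fits v b = load≤1 (colorClass? v b (e , a))
    where
    load≤1 : Dec (Incident v e × a ≡ b) → load ((e , a) ∷ κ) v b ≤ 1#
    load≤1 (yes p@(inc , ≡.refl)) = ≡.subst (λ ps → totalWeight (map proj₁ ps) ≤ 1#)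
      (≡.sym (filter-accept (colorClass? v b) {e , a} {κ} p)) (fits inc)
    load≤1 (no ¬p) = ≡.subst (λ ps → totalWeight (map proj₁ ps) ≤ 1#)
      (≡.sym (filter-reject (colorClass? v b) {e , a} {κ} ¬p)) (proper v b)

  -- `open-class` makes an open color a single bin of one type, the same from both ends.
  -- `used-notEmpty` says that an empty color carries no load. `open-adjacent` ties the number of
  -- open colors to the neighbors in the final graph.
  record Consistent (s : State) : Set (c Level.⊔ ℓ₂) where
    field
      open-sym       : ∀ u v τ → openColor s u v τ ≡ openColor s v u τ
      open-class     : ∀ {u v τ a e} → openColor s u v τ ≡ just a → (e , a) ∈ coloring s →
                       Incident u e → Joins u v e × typeOf e ≡ τ
      open-unique    : ∀ {u v v′ τ τ′ a} → openColor s u v τ ≡ just a →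
                       openColor s u v′ τ′ ≡ just a → v ≡ v′ × τ ≡ τ′
      open-notClosed : ∀ {u v τ a} → openColor s u v τ ≡ just a → a ∉ closed s u
      open-adjacent  : ∀ {u v τ a} → openColor s u v τ ≡ just a → Any (Joins u v) (edges G)
      used-notEmpty  : ∀ {u a e} → (e , a) ∈ coloring s → Incident u e → ¬ Empty s u a
      isProper       : Proper (coloring s)

    open-slot : ∀ e {x} → OpenFor s e x → ∀ {u v} → Joins u v e → openColor s u v (typeOf e) ≡ x
    open-slot e eq (inj₁ (≡.refl , ≡.refl)) = eq
    open-slot e eq (inj₂ (≡.refl , ≡.refl)) =
      ≡.trans (open-sym (end₂ e) (end₁ e) (typeOf e)) eq

    open-incident : ∀ e {x} → OpenFor s e x → ∀ {u} → Incident u e →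
                    ∃ λ v → Joins u v e × openColor s u v (typeOf e) ≡ x
    open-incident e eq inc with v , j ← incident⇒joins e inc = v , j , open-slot e eq j

  open Consistent

  initial-consistent : Consistent initial
  initial-consistent = record
    { open-sym       = λ _ _ _ → ≡.refl
    ; open-class     = λ ()
    ; open-unique    = λ ()
    ; open-notClosed = λ ()
    ; open-adjacent  = λ ()
    ; used-notEmpty  = λ ()
    ; isProper       = λ _ _ → 0≤1
    }

  assign-consistent : ∀ {s e a} → Consistent s → OpenFor s e (just a) →
                      Proper ((e , a) ∷ coloring s) → Consistent (assign e a s)
  assign-consistent {s} {e} {a} I openA proper = record
    { open-sym       = open-sym I
    ; open-class     = class
    ; open-unique    = open-unique I
    ; open-notClosed = open-notClosed I
    ; open-adjacent  = open-adjacent I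
    ; used-notEmpty  = used
    ; isProper       = proper
    }
    where
    class : ∀ {u v τ b f} → openColor s u v τ ≡ just b → (f , b) ∈ (e , a) ∷ coloring s →
            Incident u f → Joins u v f × typeOf f ≡ τ
    class eq (here ≡.refl) inc with w , j , eq′ ← open-incident I e openA inc
                               with ≡.refl , ≡.refl ← open-unique I eq eq′ = j , ≡.refl
    class eq (there f∈)    inc = open-class I eq f∈ inc

    used : ∀ {u b f} → (f , b) ∈ (e , a) ∷ coloring s → Incident u f → ¬ Empty s u b
    used (here ≡.refl) inc (notOpen , _) with w , _ , eq ← open-incident I e openA inc =
      notOpen (w , _ , eq)
    used (there f∈)    inc = used-notEmpty I f∈ inc

  setOpen-sym : ∀ {s} e x → Consistent s → ∀ u v τ →
                openColor (setOpen e x s) u v τ ≡ openColor (setOpen e x s) v u τ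
  setOpen-sym {s} e x I u v τ with setOpen-cases e x s u v τ | setOpen-cases e x s v u τ
  ... | inj₁ (_ , eq)       | inj₁ (_ , eq′)       = ≡.trans eq (≡.sym eq′)
  ... | inj₁ ((j , p) , _)  | inj₂ (¬slot , _)     = contradiction (joins-sym {e = e} j , p) ¬slot
  ... | inj₂ (¬slot , _)    | inj₁ ((j , p) , _)   = contradiction (joins-sym {e = e} j , p) ¬slot
  ... | inj₂ (_ , eq)       | inj₂ (_ , eq′)       = ≡.trans eq (≡.trans (open-sym I u v τ) (≡.sym eq′))

  close-nothing : ∀ e a s → OpenFor (close e a s) e nothing
  close-nothing e a s with setOpen-cases e nothing s (end₁ e) (end₂ e) (typeOf e)
  ... | inj₁ (_ , eq)    = eq
  ... | inj₂ (¬slot , _) = contradiction (joins-ends e , ≡.refl) ¬slot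

  -- Two points need care. By `open-unique` the cleared slot was the only one at each end where `a`
  -- was open, so `a` is not both open and closed. And `a` does not turn empty, since it joins the
  -- closed colors at both ends.
  close-consistent : ∀ {s e a} → Consistent s → OpenFor s e (just a) → Consistent (close e a s)
  close-consistent {s} {e} {a} I openA = record
    { open-sym       = setOpen-sym e nothing I
    ; open-class     = λ eq → open-class I (proj₂ (before eq))
    ; open-unique    = λ eq eq′ → open-unique I (proj₂ (before eq)) (proj₂ (before eq′))
    ; open-notClosed = notClosed
    ; open-adjacent  = λ eq → open-adjacent I (proj₂ (before eq))
    ; used-notEmpty  = λ f∈ inc empty → used-notEmpty I f∈ inc (emptyBefore empty)
    ; isProper       = isProper I
    }
    where
    s′ : State
    s′ = close e a s

    before : ∀ {u v τ b} → openColor s′ u v τ ≡ just b → ¬ Slot u v τ e × openColor s u v τ ≡ just b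
    before {u} {v} {τ} eq with setOpen-cases e nothing s u v τ
    ... | inj₁ (_ , eq′)     = contradiction (≡.trans (≡.sym eq) eq′) λ ()
    ... | inj₂ (¬slot , eq′) = ¬slot , ≡.trans (≡.sym eq′) eq

    notClosed : ∀ {u v τ b} → openColor s′ u v τ ≡ just b → b ∉ closed s′ u
    notClosed {u} eq b∈ with before eq | close-cases e a s u
    ... | _     , eq′ | inj₂ (_ , closed≡) = open-notClosed I eq′ (≡.subst (_ ∈_) closed≡ b∈)
    ... | ¬slot , eq′ | inj₁ (inc , closed≡) with ≡.subst (_ ∈_) closed≡ b∈
    ...   | there b∈s   = open-notClosed I eq′ b∈s
    ...   | here ≡.refl with w , j , eq″ ← open-incident I e openA inc
                        with ≡.refl , ≡.refl ← open-unique I eq′ eq″ = ¬slot (j , ≡.refl)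

    closed-grows : ∀ {u b} → b ∈ closed s u → b ∈ closed s′ u
    closed-grows {u} b∈ with close-cases e a s u
    ... | inj₁ (_ , eq) = ≡.subst (_ ∈_) (≡.sym eq) (there b∈)
    ... | inj₂ (_ , eq) = ≡.subst (_ ∈_) (≡.sym eq) b∈

    a∈closed : ∀ {u} → Incident u e → a ∈ closed s′ u
    a∈closed {u} inc with close-cases e a s u
    ... | inj₁ (_ , eq)   = ≡.subst (a ∈_) (≡.sym eq) (here ≡.refl)
    ... | inj₂ (¬inc , _) = contradiction inc ¬inc

    emptyBefore : ∀ {u b} → Empty s′ u b → Empty s u b
    emptyBefore {u} {b} (notOpen , b∉) = notOpenBefore , b∉ ∘ closed-grows
      where
      notOpenBefore : ¬ ∃ λ v → ∃ λ τ → openColor s u v τ ≡ just b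
      notOpenBefore (v , τ , eq) with setOpen-cases e nothing s u v τ
      ... | inj₂ (_ , eq′)          = notOpen (v , τ , ≡.trans eq′ eq)
      ... | inj₁ ((j , ≡.refl) , _) with ≡.refl ← ≡.trans (≡.sym eq) (open-slot I e openA j) =
        b∉ (a∈closed (joins⇒incident {e = e} j))

  openNew : E → Fin N → State → State
  openNew e a s = assign e a (setOpen e (just a) s)

  -- As `a` is empty at both ends, no edge there bears it yet, by `used-notEmpty`. So the new bin
  -- contains `e` alone, which fits because its weight is at most `1#`.
  openNew-consistent : ∀ {s e a} → Consistent s → e ∈ edges G → OpenFor s e nothing →
                       Empty s (end₁ e) a → Empty s (end₂ e) a → Consistent (openNew e a s)
  openNew-consistent {s} {e} {a} I e∈G noOpen empty₁ empty₂ = record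
    { open-sym       = setOpen-sym e (just a) I
    ; open-class     = class
    ; open-unique    = unique
    ; open-notClosed = notClosed
    ; open-adjacent  = adjacent
    ; used-notEmpty  = used
    ; isProper       = proper-∷ (isProper I) fits
    }
    where
    s′ : State
    s′ = openNew e a s

    emptyAt : ∀ {u} → Incident u e → Empty s u a
    emptyAt (inj₁ ≡.refl) = empty₁
    emptyAt (inj₂ ≡.refl) = empty₂

    cases : ∀ {u v τ b} → openColor s′ u v τ ≡ just b →
            (Slot u v τ e × b ≡ a) ⊎ openColor s u v τ ≡ just b
    cases {u} {v} {τ} eq with setOpen-cases e (just a) s u v τ
    ... | inj₂ (_ , eq′)    = inj₂ (≡.trans (≡.sym eq′) eq)
    ... | inj₁ (slot , eq′) with ≡.refl ← ≡.trans (≡.sym eq) eq′ = inj₁ (slot , ≡.refl)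

    class : ∀ {u v τ b f} → openColor s′ u v τ ≡ just b → (f , b) ∈ (e , a) ∷ coloring s →
            Incident u f → Joins u v f × typeOf f ≡ τ
    class eq f∈ inc with cases eq | f∈
    ... | inj₁ ((j , p) , ≡.refl) | here ≡.refl = j , ≡.sym p
    ... | inj₁ ((j , p) , ≡.refl) | there f∈s   =
      contradiction (emptyAt (joins⇒incident {e = e} j)) (used-notEmpty I f∈s inc)
    ... | inj₂ eq′ | here ≡.refl = contradiction (_ , _ , eq′) (proj₁ (emptyAt inc))
    ... | inj₂ eq′ | there f∈s   = open-class I eq′ f∈s inc

    unique : ∀ {u v v′ τ τ′ b} → openColor s′ u v τ ≡ just b → openColor s′ u v′ τ′ ≡ just b →
             v ≡ v′ × τ ≡ τ′
    unique eq eq′ with cases eq | cases eq′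
    ... | inj₁ ((j , p) , _)      | inj₁ ((j′ , p′) , _) =
      joins-functional {e = e} j j′ , ≡.trans p (≡.sym p′)
    ... | inj₁ ((j , _) , ≡.refl) | inj₂ old  =
      contradiction (_ , _ , old) (proj₁ (emptyAt (joins⇒incident {e = e} j)))
    ... | inj₂ old | inj₁ ((j , _) , ≡.refl)  =
      contradiction (_ , _ , old) (proj₁ (emptyAt (joins⇒incident {e = e} j)))
    ... | inj₂ old | inj₂ old′                = open-unique I old old′

    notClosed : ∀ {u v τ b} → openColor s′ u v τ ≡ just b → b ∉ closed s u
    notClosed eq with cases eq
    ... | inj₁ ((j , _) , ≡.refl) = proj₂ (emptyAt (joins⇒incident {e = e} j))
    ... | inj₂ old                = open-notClosed I old

    adjacent : ∀ {u v τ b} → openColor s′ u v τ ≡ just b → Any (Joins u v) (edges G)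
    adjacent eq with cases eq
    ... | inj₁ ((j , _) , _) = lose e∈G j
    ... | inj₂ old           = open-adjacent I old

    used : ∀ {u b f} → (f , b) ∈ (e , a) ∷ coloring s → Incident u f → ¬ Empty s′ u b
    used {u} (here ≡.refl) inc (notOpen , _) with v , j ← incident⇒joins e inc
      with setOpen-cases e (just a) s u v (typeOf e)
    ... | inj₁ (_ , eq)    = notOpen (v , _ , eq)
    ... | inj₂ (¬slot , _) = ¬slot (j , ≡.refl)
    used {u} {b} (there f∈) inc (notOpen , b∉) = used-notEmpty I f∈ inc (notOpenBefore , b∉)
      where
      notOpenBefore : ¬ ∃ λ v → ∃ λ τ → openColor s u v τ ≡ just b
      notOpenBefore (v , τ , eq) with setOpen-cases e (just a) s u v τ
      ... | inj₂ (_ , eq′)          = notOpen (v , τ , ≡.trans eq′ eq)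
      -- The overwritten slot held `nothing`, so no open color is lost and none becomes empty again.
      ... | inj₁ ((j , ≡.refl) , _) = contradiction (≡.trans (≡.sym eq) (open-slot I e noOpen j)) λ ()

    fits : ∀ {v} → Incident v e → totalWeight (e ∷ colorClass (coloring s) v a) ≤ 1#
    fits {v} inc = ≡.subst (λ κ → totalWeight (e ∷ map proj₁ κ) ≤ 1#)
      (≡.sym (filter-none (colorClass? v a) (All.tabulate unused)))
      (≤-trans (≤-reflexive (+-identityʳ (weight e))) (weight≤1 e))
      where
      unused : ∀ {p} → p ∈ coloring s → ¬ (Incident v (proj₁ p) × proj₂ p ≡ a)
      unused p∈ (inc′ , ≡.refl) = used-notEmpty I p∈ inc′ (emptyAt inc)

≤-maximum : ∀ {n} (f : Fin n → ℕ) i → f i ℕ.≤ maximum f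
≤-maximum f zero    = ℕ.m≤m⊔n (f zero) _
≤-maximum f (suc i) = ℕ.≤-trans (≤-maximum (f ∘ suc) i) (ℕ.m≤n⊔m (f zero) _)

-- Amortized analysis

module VertexSum {c ℓ₁ ℓ₂} (F : OrderedField c ℓ₁ ℓ₂) (n : ℕ) where

  open OrderedField F
  open OrderedFieldProperties F
  open WeightedColoring F
  open import Relation.Binary.Reasoning.PartialOrder poset

  vertexSum : (Edge n → Carrier) → Fin n → List (Edge n) → Carrier
  vertexSum f x es = ∑ f (filter (incident? x) es)

  vertexSum-++ : ∀ f x es es′ → vertexSum f x (es ++ es′) ≈ vertexSum f x es + vertexSum f x es′
  vertexSum-++ f x es es′ = begin-equality
    ∑ f (filter (incident? x) (es ++ es′))                      ≡⟨ ≡.cong (∑ f) (filter-++ (incident? x) es es′) ⟩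
    ∑ f (filter (incident? x) es ++ filter (incident? x) es′)   ≈⟨ ∑-++ f (filter (incident? x) es) _ ⟩
    vertexSum f x es + vertexSum f x es′                        ∎

  vertexSum-incident : ∀ f {x e} → Incident x e → vertexSum f x (e ∷ []) ≈ f e
  vertexSum-incident f {x} {e} inc = begin-equality
    vertexSum f x (e ∷ [])   ≡⟨ ≡.cong (∑ f) (filter-accept (incident? x) {e} {[]} inc) ⟩
    f e + 0#                 ≈⟨ +-identityʳ (f e) ⟩
    f e                      ∎

  vertexSum-mono : ∀ {f g : Edge n → Carrier} → (∀ e → f e ≤ g e) → ∀ x es → vertexSum f x es ≤ vertexSum g x es
  vertexSum-mono {f} {g} f≤g x es = go (filter (incident? x) es)
    where
    go : ∀ fs → ∑ f fs ≤ ∑ g fs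
    go []       = ≤-refl
    go (e ∷ fs) = +-mono-≤ (f≤g e) (go fs)

module _
  {c ℓ₁ ℓ₂} (F : OrderedField c ℓ₁ ℓ₂) (G : WeightedColoring.Multigraph F)
  {K : ℕ} (type : OrderedField.Carrier F → Fin K) (N : ℕ)
  where

  open OrderedField F
  open OrderedFieldProperties F
  open WeightedColoring F
  open Algorithm type (order G) N
  open Run F G type N
  open VertexSum F (order G)
  open DecMembership (_≟ᶠ_ {N}) using (_∈?_)
  open import Relation.Binary.Reasoning.PartialOrder poset
  open CommutativeSemigroupProperties +-commutativeSemigroup using (x∙yz≈y∙xz; interchange)

  step-nothing : ∀ {s e} → OpenFor s e nothing → step s e ≡ useNewColor e s
  step-nothing {s} {e} eq with openColor s (end₁ e) (end₂ e) (typeOf e)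
  step-nothing ≡.refl | nothing = ≡.refl

  step-just : ∀ {s e a} → OpenFor s e (just a) →
              step s e ≡ (if does (proper? ((e , a) ∷ coloring s))
                          then just (assign e a s) else useNewColor e (close e a s))
  step-just {s} {e} eq with openColor s (end₁ e) (end₂ e) (typeOf e)
  step-just ≡.refl | just a = ≡.refl

  -- In `overflow` the left side is what a closing needs, one unit and the reserve of `e` for its
  -- next bin; the right side is what becomes available, the reserves of the closed bin and the
  -- payment of `e`. `closed-bound` takes two vertices because a new color must avoid the closed
  -- colors of both ends.
  module Amortized
    (unit : Carrier) (φ ψ : E → Carrier)
    (0≤ψ : ∀ e → 0# ≤ ψ e) (ψ≤φ : ∀ e → ψ e ≤ φ e)
    (overflow : ∀ e bin → All (λ e′ → typeOf e′ ≡ typeOf e) bin →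
                ¬ totalWeight (e ∷ bin) ≤ 1# → unit + ψ e ≤ ∑ ψ bin + φ e)
    (C : ℕ)
    (closed-bound : ∀ x y p q → p · unit ≤ vertexSum φ x (edges G) →
                    q · unit ≤ vertexSum φ y (edges G) → p ℕ.+ q ℕ.≤ C)
    (enough : C ℕ.+ 2 ℕ.* (K ℕ.* maxNeighbors G) ℕ.≤ N)
    where

    0≤φ : ∀ e → 0# ≤ φ e
    0≤φ e = ≤-trans (0≤ψ e) (ψ≤φ e)

    live? : ∀ (cl : List (Fin N)) x → Decidable (λ ((e , b) : E × Fin N) → Incident x e × b ∉ cl)
    live? cl x (e , b) = incident? x e ×-dec ¬? (b ∈? cl)

    liveSum : Coloring (order G) N → List (Fin N) → Vertex → Carrier
    liveSum κ cl x = ∑ (ψ ∘ proj₁) (filter (live? cl x) κ)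

    liveSum-nonNegative : ∀ κ cl x → 0# ≤ liveSum κ cl x
    liveSum-nonNegative κ cl x = ∑-nonNegative (0≤ψ ∘ proj₁) (filter (live? cl x) κ)

    -- Only an inequality, since the reserve of `e` is dropped when `a` is already in `cl`.
    liveSum-∷ : ∀ κ cl x e a → liveSum ((e , a) ∷ κ) cl x ≤ vertexSum ψ x (e ∷ []) + liveSum κ cl x
    liveSum-∷ κ cl x e a = by (live? cl x (e , a))
      where
      by : Dec (Incident x e × a ∉ cl) →
           liveSum ((e , a) ∷ κ) cl x ≤ vertexSum ψ x (e ∷ []) + liveSum κ cl x
      by (yes p) = begin
        liveSum ((e , a) ∷ κ) cl x                  ≡⟨ ≡.cong (∑ (ψ ∘ proj₁)) (filter-accept (live? cl x) {e , a} {κ} p) ⟩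
        ψ e + liveSum κ cl x                        ≈⟨ +-congʳ (vertexSum-incident ψ {x} {e} (proj₁ p)) ⟨
        vertexSum ψ x (e ∷ []) + liveSum κ cl x     ∎
      by (no ¬p) = begin
        liveSum ((e , a) ∷ κ) cl x                  ≡⟨ ≡.cong (∑ (ψ ∘ proj₁)) (filter-reject (live? cl x) {e , a} {κ} ¬p) ⟩
        liveSum κ cl x                              ≤⟨ x≤y+x (∑-nonNegative 0≤ψ (filter (incident? x) (e ∷ []))) ⟩
        vertexSum ψ x (e ∷ []) + liveSum κ cl x     ∎

    ∑-map-proj₁ : ∀ f (κ : Coloring (order G) N) → ∑ (f ∘ proj₁) κ ≡ ∑ f (map proj₁ κ)
    ∑-map-proj₁ f []      = ≡.refl
    ∑-map-proj₁ f (p ∷ κ) = ≡.cong (f (proj₁ p) +_) (∑-map-proj₁ f κ)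

    -- Because `a` was not closed before, its whole class was live, and closing releases all of its
    -- reserves.
    liveSum-close : ∀ κ cl x a → a ∉ cl →
                    liveSum κ cl x ≈ liveSum κ (a ∷ cl) x + ∑ ψ (colorClass κ x a)
    liveSum-close κ cl x a a∉cl = begin-equality
      liveSum κ cl x                                                         ≈⟨ ∑-split (live? cl x) (live? (a ∷ cl) x) (colorClass? x a)
                                                                                  divide keep recover disjoint (ψ ∘ proj₁) κ ⟩
      liveSum κ (a ∷ cl) x + ∑ (ψ ∘ proj₁) (filter (colorClass? x a) κ)      ≡⟨ ≡.cong (liveSum κ (a ∷ cl) x +_)
                                                                                  (∑-map-proj₁ ψ (filter (colorClass? x a) κ)) ⟩
      liveSum κ (a ∷ cl) x + ∑ ψ (colorClass κ x a)                          ∎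
      where
      Live : List (Fin N) → E × Fin N → Set
      Live cl′ (e , b) = Incident x e × b ∉ cl′

      InClass : E × Fin N → Set
      InClass (e , b) = Incident x e × b ≡ a

      divide : ∀ p → Live cl p → Live (a ∷ cl) p ⊎ InClass p
      divide (e , b) (inc , b∉) with b ≟ᶠ a
      ... | yes b≡a = inj₂ (inc , b≡a)
      ... | no  b≢a = inj₁ (inc , λ { (here b≡a) → b≢a b≡a ; (there b∈) → b∉ b∈ })

      keep : ∀ p → Live (a ∷ cl) p → Live cl p
      keep _ (inc , b∉) = inc , b∉ ∘ there

      recover : ∀ p → InClass p → Live cl p
      recover _ (inc , ≡.refl) = inc , a∉cl

      disjoint : ∀ p → Live (a ∷ cl) p → ¬ InClass p
      disjoint _ (_ , b∉) (_ , b≡a) = b∉ (here b≡a)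

    colored : State → List E
    colored s = map proj₁ (coloring s)

    -- Every closed color has cost one unit; each edge pays φ in total, of which
    -- ψ is still available as long as the color of the edge is not closed.
    Balanced : State → Set ℓ₂
    Balanced s = ∀ x →
      length (closed s x) · unit + liveSum (coloring s) (closed s x) x ≤ vertexSum φ x (colored s)

    -- The balance while a color for `e` is being sought: `e` has paid `φ` and its `ψ` is reserved,
    -- but it is not yet colored. The term `vertexSum ψ x (e ∷ [])` is `ψ e` at the ends of `e` and
    -- zero elsewhere, so one inequality serves all vertices.
    Affords : State → E → Set ℓ₂
    Affords s e = ∀ x →
      length (closed s x) · unit + (vertexSum ψ x (e ∷ []) + liveSum (coloring s) (closed s x) x)
      ≤ vertexSum φ x (e ∷ colored s)

    initial-balanced : Balanced initial
    initial-balanced x = ≤-reflexive (begin-equality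
      0 · unit + 0#   ≈⟨ +-identityʳ (0 · unit) ⟩
      0 · unit        ≈⟨ 0·x unit ⟩
      0#              ∎)

    balanced⇒affords : ∀ {s e} → Balanced s → Affords s e
    balanced⇒affords {s} {e} balanced x = begin
      len + (vertexSum ψ x (e ∷ []) + live)         ≈⟨ x∙yz≈y∙xz len _ live ⟩
      vertexSum ψ x (e ∷ []) + (len + live)         ≤⟨ +-mono-≤ (vertexSum-mono ψ≤φ x (e ∷ [])) (balanced x) ⟩
      vertexSum φ x (e ∷ []) + vertexSum φ x (colored s)  ≈⟨ vertexSum-++ φ x (e ∷ []) (colored s) ⟨
      vertexSum φ x (e ∷ colored s)                 ∎
      where
      len live : Carrier
      len  = length (closed s x) · unit
      live = liveSum (coloring s) (closed s x) x

    affords⇒balanced : ∀ {s e a} → Affords s e → Balanced (assign e a s)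
    affords⇒balanced {s} {e} {a} affords x =
      ≤-trans (+-monoʳ-≤ _ (liveSum-∷ (coloring s) (closed s x) x e a)) (affords x)

    -- By `open-class` each edge of color `a` at one end of `e` also meets the other end.
    colorClass-cong : ∀ {s e a} → Consistent s → OpenFor s e (just a) → ∀ {x y} → Incident x e → Incident y e →
                      colorClass (coloring s) x a ≡ colorClass (coloring s) y a
    colorClass-cong {s} {e} {a} I openA {x} {y} incx incy = ≡.cong (map proj₁)
      (filter-cong-∈ (colorClass? x a) (colorClass? y a) (coloring s)
        λ p∈ → transfer incx incy p∈ , transfer incy incx p∈)
      where
      open Consistent I
      sameEnds : ∀ {u v f} → Joins u v e → Joins u v f → ∀ {z} → Incident z e → Incident z f
      sameEnds (inj₁ (≡.refl , ≡.refl)) (inj₁ (p , q)) (inj₁ ≡.refl) = inj₁ p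
      sameEnds (inj₁ (≡.refl , ≡.refl)) (inj₁ (p , q)) (inj₂ ≡.refl) = inj₂ q
      sameEnds (inj₁ (≡.refl , ≡.refl)) (inj₂ (p , q)) (inj₁ ≡.refl) = inj₂ p
      sameEnds (inj₁ (≡.refl , ≡.refl)) (inj₂ (p , q)) (inj₂ ≡.refl) = inj₁ q
      sameEnds (inj₂ (≡.refl , ≡.refl)) (inj₁ (p , q)) (inj₁ ≡.refl) = inj₂ q
      sameEnds (inj₂ (≡.refl , ≡.refl)) (inj₁ (p , q)) (inj₂ ≡.refl) = inj₁ p
      sameEnds (inj₂ (≡.refl , ≡.refl)) (inj₂ (p , q)) (inj₁ ≡.refl) = inj₁ q
      sameEnds (inj₂ (≡.refl , ≡.refl)) (inj₂ (p , q)) (inj₂ ≡.refl) = inj₂ p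

      transfer : ∀ {u v} → Incident u e → Incident v e → ∀ {p} → p ∈ coloring s →
                 Incident u (proj₁ p) × proj₂ p ≡ a → Incident v (proj₁ p) × proj₂ p ≡ a
      transfer incu incv {f , _} p∈ (inc , ≡.refl) with w , j , eq ← open-incident e openA incu =
        sameEnds {f = f} j (proj₁ (open-class eq p∈ inc)) incv , ≡.refl

    -- Away from `e` nothing is closed. At an end of `e` the reserves of the class of `a` are
    -- released, and with `φ e` they cover the unit and the reserve `ψ e`, by `overflow`.
    close-affords : ∀ {s e a} → Consistent s → Balanced s → OpenFor s e (just a) →
                    ¬ Proper ((e , a) ∷ coloring s) → Affords (close e a s) e
    close-affords {s} {e} {a} I balanced openA improper x with close-cases e a s x
    ... | inj₂ (_ , closed≡) = ≡.subst
      (λ cl → length cl · unit + (vertexSum ψ x (e ∷ []) + liveSum (coloring s) cl x) ≤ vertexSum φ x (e ∷ colored s))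
      (≡.sym closed≡) (balanced⇒affords {s} {e} balanced x)
    ... | inj₁ (inc , closed≡) = ≡.subst
      (λ cl → length cl · unit + (vertexSum ψ x (e ∷ []) + liveSum (coloring s) cl x) ≤ vertexSum φ x (e ∷ colored s))
      (≡.sym closed≡) (begin
        suc (length (closed s x)) · unit + (vertexSum ψ x (e ∷ []) + live′)
          ≈⟨ +-cong (suc· (length (closed s x)) unit) (+-congʳ (vertexSum-incident ψ {x} {e} inc)) ⟩
        (unit + len) + (ψ e + live′)
          ≈⟨ interchange unit len (ψ e) live′ ⟩
        (unit + ψ e) + (len + live′)
          ≤⟨ +-monoˡ-≤ (len + live′) (overflow e class sameType overfull) ⟩
        (∑ ψ class + φ e) + (len + live′)
          ≈⟨ interchange (∑ ψ class) (φ e) len live′ ⟩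
        (∑ ψ class + len) + (φ e + live′)
          ≈⟨ +-congʳ (+-comm (∑ ψ class) len) ⟩
        (len + ∑ ψ class) + (φ e + live′)
          ≈⟨ interchange len (∑ ψ class) (φ e) live′ ⟩
        (len + φ e) + (∑ ψ class + live′)
          ≈⟨ +-cong (+-comm len (φ e)) (+-comm (∑ ψ class) live′) ⟩
        (φ e + len) + (live′ + ∑ ψ class)
          ≈⟨ +-assoc (φ e) len (live′ + ∑ ψ class) ⟩
        φ e + (len + (live′ + ∑ ψ class))
          ≈⟨ +-congˡ (+-congˡ (liveSum-close (coloring s) (closed s x) x a a∉)) ⟨
        φ e + (len + liveSum (coloring s) (closed s x) x)
          ≤⟨ +-monoʳ-≤ (φ e) (balanced x) ⟩
        φ e + vertexSum φ x (colored s)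
          ≈⟨ +-congʳ (vertexSum-incident φ {x} {e} inc) ⟨
        vertexSum φ x (e ∷ []) + vertexSum φ x (colored s)
          ≈⟨ vertexSum-++ φ x (e ∷ []) (colored s) ⟨
        vertexSum φ x (e ∷ colored s) ∎)
      where
      open Consistent I
      class : List E
      class = colorClass (coloring s) x a

      len live′ : Carrier
      len   = length (closed s x) · unit
      live′ = liveSum (coloring s) (a ∷ closed s x) x

      slot : ∃ λ v → Joins x v e × openColor s x v (typeOf e) ≡ just a
      slot = open-incident e openA inc

      a∉ : a ∉ closed s x
      a∉ = open-notClosed (proj₂ (proj₂ slot))

      sameType : All (λ e′ → typeOf e′ ≡ typeOf e) class
      sameType = All.tabulate λ f∈ → typed (∈-map⁻ proj₁ f∈)
        where
        typed : ∀ {f} → (∃ λ p → p ∈ filter (colorClass? x a) (coloring s) × f ≡ proj₁ p) → typeOf f ≡ typeOf e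
        typed (p , p∈ , ≡.refl) with p∈κ , inc′ , ≡.refl ← ∈-filter⁻ (colorClass? x a) {xs = coloring s} p∈ =
          proj₂ (open-class (proj₂ (proj₂ slot)) p∈κ inc′)

      -- Failure of properness does not say at which end. But both ends see the same class, so
      -- fitting at `x` would mean fitting everywhere.
      overfull : ¬ totalWeight (e ∷ class) ≤ 1#
      overfull fits = improper (proper-∷ isProper λ {v} inc′ →
        ≡.subst (λ es → totalWeight (e ∷ es) ≤ 1#) (colorClass-cong {s} {e} I openA inc inc′) fits)

    slots : Vertex → List (Vertex × Fin K)
    slots x = cartesianProduct (neighbors G x) (allFin K)

    openColors : State → Vertex → List (Fin N)
    openColors s x = mapMaybe (λ (v , τ) → openColor s x v τ) (slots x)

    ∈-slots : ∀ {x v} τ → Any (Joins x v) (edges G) → (v , τ) ∈ slots x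
    ∈-slots {x} {v} τ adj = ∈-cartesianProduct⁺
      (∈-filter⁺ (λ u → Any.any? (joins? x u) (edges G)) (∈-allFin v) adj) (∈-allFin τ)

    notListed⇒empty : ∀ {s x a} → Consistent s → a ∉ closed s x ++ openColors s x → Empty s x a
    notListed⇒empty {s} {x} {a} I a∉ =
      (λ (v , τ , eq) → a∉ (∈-++⁺ʳ (closed s x) (∈-mapMaybe⁺ (λ (v , τ) → openColor s x v τ)
                           (slots x) (∈-slots τ (open-adjacent eq)) eq)))
      , a∉ ∘ ∈-++⁺ˡ
      where open Consistent I

    openColors-length : ∀ {s e} → Consistent s → e ∈ edges G → OpenFor s e nothing →
                        ∀ {x} → Incident x e → length (openColors s x) ℕ.< K ℕ.* maxNeighbors G
    openColors-length {s} {e} I e∈G noOpen {x} inc with v , j , eq ← Consistent.open-incident I e noOpen inc =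
      ℕ.<-≤-trans
        (length-mapMaybe-< (λ (v , τ) → openColor s x v τ) (slots x) (∈-slots (typeOf e) (lose e∈G j)) eq)
        (ℕ.≤-trans (ℕ.≤-reflexive (≡.trans (length-cartesianProduct (neighbors G x) (allFin K))
                                    (≡.trans (≡.cong (length (neighbors G x) ℕ.*_) (length-tabulate {n = K} id))
                                      (ℕ.*-comm (length (neighbors G x)) K))))
                   (ℕ.*-monoʳ-≤ K (≤-maximum (length ∘ neighbors G) x)))

    -- The permutation records that past and future arrivals make up the final graph, against which
    -- payments are measured.
    Invariant : State → List E → Set _
    Invariant s rest = Consistent s × Balanced s × colored s ++ rest ↭ edges G

    -- Reserves are nonnegative and may be dropped on the left; future payments are nonnegative and
    -- may be added on the right.
    closed-affordable : ∀ {s e rest} → Affords s e → colored s ++ e ∷ rest ↭ edges G →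
                        ∀ x → length (closed s x) · unit ≤ vertexSum φ x (edges G)
    closed-affordable {s} {e} {rest} affords perm x = begin
      length (closed s x) · unit
        ≤⟨ x≤x+y (+-nonNegative (∑-nonNegative 0≤ψ (filter (incident? x) (e ∷ [])))
                                (liveSum-nonNegative (coloring s) (closed s x) x)) ⟩
      length (closed s x) · unit + (vertexSum ψ x (e ∷ []) + liveSum (coloring s) (closed s x) x)
        ≤⟨ affords x ⟩
      vertexSum φ x (e ∷ colored s)
        ≤⟨ x≤x+y (∑-nonNegative 0≤φ (filter (incident? x) rest)) ⟩
      vertexSum φ x (e ∷ colored s) + vertexSum φ x rest
        ≈⟨ vertexSum-++ φ x (e ∷ colored s) rest ⟨
      vertexSum φ x (e ∷ colored s ++ rest)
        ≈⟨ ∑-↭ φ (filter-↭ (incident? x) (↭.trans (↭-sym (shift e (colored s) rest)) perm)) ⟩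
      vertexSum φ x (edges G) ∎

    emptyColor : ∀ {s e rest} → Consistent s → Affords s e → OpenFor s e nothing →
                 colored s ++ e ∷ rest ↭ edges G → e ∈ edges G →
                 ∃ λ a → Empty s (end₁ e) a × Empty s (end₂ e) a
    emptyColor {s} {e} {rest} I affords noOpen perm e∈G =
      let a , a∉ = ∃∉ (nonEmpty u ++ nonEmpty v) fewerThanN in
      a , notListed⇒empty I (a∉ ∘ ∈-++⁺ˡ) , notListed⇒empty I (a∉ ∘ ∈-++⁺ʳ (nonEmpty u))
      where
      u v : Vertex
      u = end₁ e
      v = end₂ e

      nonEmpty : Vertex → List (Fin N)
      nonEmpty x = closed s x ++ openColors s x

      p q k l T : ℕ
      p = length (closed s u)
      q = length (closed s v)
      k = length (openColors s u)
      l = length (openColors s v)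
      T = K ℕ.* maxNeighbors G

      closed≤ : p ℕ.+ q ℕ.≤ C
      closed≤ = closed-bound u v p q (closed-affordable {s} {e} {rest} affords perm u)
                                     (closed-affordable {s} {e} {rest} affords perm v)

      open₁ : k ℕ.< T
      open₁ = openColors-length {s} {e} I e∈G noOpen (inj₁ ≡.refl)

      open₂ : l ℕ.≤ T
      open₂ = ℕ.<⇒≤ (openColors-length {s} {e} I e∈G noOpen (inj₂ ≡.refl))

      length≡ : length (nonEmpty u ++ nonEmpty v) ≡ (p ℕ.+ k) ℕ.+ (q ℕ.+ l)
      length≡ = ≡.trans (length-++ (nonEmpty u))
                  (≡.cong₂ ℕ._+_ (length-++ (closed s u)) (length-++ (closed s v)))

      twice : T ℕ.+ T ≡ 2 ℕ.* T
      twice = ≡.cong (T ℕ.+_) (≡.sym (ℕ.+-identityʳ T))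

      rearranged : (p ℕ.+ k) ℕ.+ (q ℕ.+ l) ≡ (p ℕ.+ q) ℕ.+ (k ℕ.+ l)
      rearranged = CommutativeSemigroupProperties.interchange ℕ.+-commutativeSemigroup p k q l

      -- The vacant slot at `u` already gives the strictness required by `∃∉`.
      fewerThanN : length (nonEmpty u ++ nonEmpty v) ℕ.< N
      fewerThanN = ℕ.<-≤-trans
        (≡.subst₂ ℕ._<_ (≡.sym (≡.trans length≡ rearranged)) (≡.cong (C ℕ.+_) twice)
          (ℕ.+-mono-≤-< closed≤ (ℕ.+-mono-<-≤ open₁ open₂)))
        enough

    -- Serves both the first edge of a slot and an edge whose old color has just been closed: in
    -- either case the slot is vacant and `Affords` holds.
    useNewColor-succeeds : ∀ {s e rest} → Consistent s → Affords s e → OpenFor s e nothing →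
                           colored s ++ e ∷ rest ↭ edges G →
                           ∃ λ s′ → useNewColor e s ≡ just s′ × Invariant s′ rest
    useNewColor-succeeds {s} {e} {rest} I affords noOpen perm =
      let e∈G = ∈-resp-↭ perm (∈-++⁺ʳ (colored s) (here ≡.refl))
          b , both = emptyColor {s} {e} {rest} I affords noOpen perm e∈G
          a , found , empty₁ , empty₂ = find-succeeds
            (λ a → empty? s (end₁ e) a ×-dec empty? s (end₂ e) a) (allFin N) (∈-allFin b) both
      in openNew e a s
         , ≡.cong (Maybe.map λ a → openNew e a s) found
         , openNew-consistent I e∈G noOpen empty₁ empty₂
         , affords⇒balanced {setOpen e (just a) s} affords
         , ↭.trans (↭-sym (shift e (colored s) rest)) perm

    step-succeeds : ∀ {s e rest} → Invariant s (e ∷ rest) →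
                    ∃ λ s′ → step s e ≡ just s′ × Invariant s′ rest
    step-succeeds {s} {e} {rest} (I , balanced , perm) = by (openColor s (end₁ e) (end₂ e) (typeOf e)) ≡.refl
      where
      by : ∀ x → OpenFor s e x → ∃ λ s′ → step s e ≡ just s′ × Invariant s′ rest
      by nothing noOpen =
        let s′ , new≡ , inv = useNewColor-succeeds {s} {e} {rest} I (balanced⇒affords {s} {e} balanced) noOpen perm
        in s′ , ≡.trans (step-nothing noOpen) new≡ , inv
      by (just a) openA
        with if-cases (proper? ((e , a) ∷ coloring s)) (just (assign e a s)) (useNewColor e (close e a s))
      ... | inj₁ (proper , if≡) =
        assign e a s , ≡.trans (step-just openA) if≡ , assign-consistent I openA proper ,
        affords⇒balanced {s} (balanced⇒affords {s} {e} balanced) ,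
        ↭.trans (↭-sym (shift e (colored s) rest)) perm
      ... | inj₂ (improper , if≡) =
        let s′ , new≡ , inv = useNewColor-succeeds {close e a s} {e} {rest} (close-consistent {s} {e} {a} I openA)
                                (close-affords {s} I balanced openA improper) (close-nothing e a s) perm
        in s′ , ≡.trans (step-just openA) (≡.trans if≡ new≡) , inv

    runFrom-succeeds : ∀ {s} es {rest} → Invariant s (es ++ rest) →
                       ∃ λ s′ → runFrom s es ≡ just s′ × Invariant s′ rest
    runFrom-succeeds {s} []       inv = s , ≡.refl , inv
    runFrom-succeeds {s} (e ∷ es) inv with step s e | step-succeeds inv
    ... | _ | s′ , ≡.refl , inv′ = runFrom-succeeds {s′} es inv′

    succeeds : ∀ arrivals → arrivals ↭ edges G → Succeeds arrivals
    succeeds arrivals perm before after ≡.refl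
      with s , run≡ , I , _ ← runFrom-succeeds {initial} before {after} (initial-consistent , initial-balanced , perm)
      = s , run≡ , Consistent.isProper I

module _ {a p} {A : Set a} {P : Pred A p} (P? : Decidable P) where

  find-just : ∀ xs {x} → find P? xs ≡ just x → P x
  find-just (x ∷ xs) eq with P? x
  find-just (x ∷ xs) ≡.refl | yes px = px
  ... | no _ = find-just xs eq

  find-nothing : ∀ xs → find P? xs ≡ nothing → All (¬_ ∘ P) xs
  find-nothing []       eq = []
  find-nothing (x ∷ xs) eq with P? x
  ... | no ¬px = ¬px ∷ find-nothing xs eq

-- Harmonic weights

-- This is `(n+1)/n ≤ (m+1)/m`, multiplied out with a common factor `q`.
ratio-monotone : ∀ {m n} q → m ℕ.≤ n → m ℕ.* (q ℕ.* suc n) ℕ.≤ suc m ℕ.* (n ℕ.* q)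
ratio-monotone {m} {n} q m≤n = begin
  m ℕ.* (q ℕ.* suc n)              ≡⟨ ≡.cong (m ℕ.*_) (ℕ.*-suc q n) ⟩
  m ℕ.* (q ℕ.+ q ℕ.* n)            ≡⟨ ℕ.*-distribˡ-+ m q (q ℕ.* n) ⟩
  m ℕ.* q ℕ.+ m ℕ.* (q ℕ.* n)      ≡⟨ ≡.cong (λ k → m ℕ.* q ℕ.+ m ℕ.* k) (ℕ.*-comm q n) ⟩
  m ℕ.* q ℕ.+ m ℕ.* (n ℕ.* q)      ≤⟨ ℕ.+-monoˡ-≤ (m ℕ.* (n ℕ.* q)) (ℕ.*-monoˡ-≤ q m≤n) ⟩
  n ℕ.* q ℕ.+ m ℕ.* (n ℕ.* q)      ∎
  where open ℕ.≤-Reasoning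

module Harmonic {c ℓ₁ ℓ₂} (F : OrderedField c ℓ₁ ℓ₂) where

  open OrderedField F
  open OrderedFieldProperties F
  open WeightedColoring F
  open import Relation.Binary.Reasoning.PartialOrder poset

  InInterval : Carrier → Fin 11 → Set _
  InInterval x i = 1/suc (suc (toℕ i)) < x × x ≤ 1/suc (toℕ i)

  inInterval? : ∀ x i → Dec (InInterval x i)
  inInterval? x i = (1/suc (suc (toℕ i)) <? x) ×-dec (x ≤? 1/suc (toℕ i))

  toType : Maybe (Fin 11) → Fin 12
  toType = maybe inject₁ (fromℕ 11)

  opaque
    interval : Carrier → Maybe (Fin 11)
    interval x = find (inInterval? x) (allFin 11)

    harmonicType≡ : ∀ x → harmonicType x ≡ toType (interval x)
    harmonicType≡ x = ≡.refl

    interval-just : ∀ {x i} → interval x ≡ just i → InInterval x i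
    interval-just {x} = find-just (inInterval? x) (allFin 11)

    interval-nothing : ∀ {x} → interval x ≡ nothing → ∀ i → ¬ InInterval x i
    interval-nothing {x} eq i = All.lookup (find-nothing (inInterval? x) (allFin 11) eq) (∈-allFin i)

  toType-injective : ∀ {i j} → toType i ≡ toType j → i ≡ j
  toType-injective {just i}  {just j}  eq = ≡.cong just (inject₁-injective eq)
  toType-injective {just i}  {nothing} eq = contradiction (≡.sym eq) fromℕ≢inject₁
  toType-injective {nothing} {just j}  eq = contradiction eq fromℕ≢inject₁
  toType-injective {nothing} {nothing} eq = ≡.refl

  -- The intervals are adjacent: from `x ≤ 1`, missing each of them in turn pushes `x` down to the
  -- next reciprocal, ending at `1/12`.
  outside⇒small : ∀ {x} → x ≤ 1# → (∀ i → ¬ InInterval x i) → 12 · x ≤ 1#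
  outside⇒small {x} x≤1 outside = ≤1/suc⇒ 11 (below 11 ℕ.≤-refl)
    where
    below : ∀ j → j ℕ.≤ 11 → x ≤ 1/suc j
    below zero    _    = begin
      x          ≤⟨ x≤1 ⟩
      1#         ≈⟨ suc·1/suc 0 ⟨
      1 · 1/suc 0 ≈⟨ 1·x (1/suc 0) ⟩
      1/suc 0    ∎
    below (suc j) j<11 = ≮⇒≥ λ >1/ → ≡.subst (λ k → ¬ (1/suc (suc k) < x × x ≤ 1/suc k))
      (toℕ-fromℕ< j<11) (outside (fromℕ< j<11)) (>1/ , below j (ℕ.<⇒≤ j<11))

  -- The usual weights of the harmonic algorithm, 1/i for type i ≤ 11 and
  -- 12/11 · w for type 12, multiplied by 27720 = lcm(1,…,12).
  harmonicPotential : Carrier → Carrier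
  harmonicPotential x =
    maybe (λ i → (27720 / suc (toℕ i)) · 1#) (30240 · x) (interval x)

  quotient-exact : (i : Fin 11) → suc (toℕ i) ℕ.* (27720 / suc (toℕ i)) ≡ 27720
  quotient-exact = from-yes (allFin? λ (i : Fin 11) → suc (toℕ i) ℕ.* (27720 / suc (toℕ i)) ℕ.≟ 27720)

  harmonicPotential-cases : ∀ {x} → x ≤ 1# →
    (∃₂ λ i q → suc i ℕ.* q ≡ 27720 × 1# < suc (suc i) · x × harmonicPotential x ≡ q · 1#)
    ⊎ (12 · x ≤ 1# × harmonicPotential x ≡ 30240 · x)
  harmonicPotential-cases {x} x≤1 with interval x in eq
  ... | just i  = inj₁ (toℕ i , 27720 / suc (toℕ i) , quotient-exact i ,
                        1/suc<⇒ (suc (toℕ i)) (proj₁ (interval-just eq)) , ≡.refl)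
  ... | nothing = inj₂ (outside⇒small x≤1 (interval-nothing eq) , ≡.refl)

  harmonicPotential-nonNegative : ∀ {x} → 0# ≤ x → 0# ≤ harmonicPotential x
  harmonicPotential-nonNegative {x} 0≤x with interval x
  ... | just i  = ·-nonNegative (27720 / suc (toℕ i)) 0≤1
  ... | nothing = ·-nonNegative 30240 0≤x

  interval-monotone : ∀ {x} i k → 0# ≤ x → 1# < suc (suc i) · x → suc k · x ≤ 1# → k ℕ.≤ i
  interval-monotone {x} i k 0≤x 1<ix kx≤1 with k ℕ.≤? i
  ... | yes k≤i = k≤i
  ... | no  k≰i = contradiction
    (≤-trans (·-monoˡ-≤ 0≤x (s≤s (ℕ.≰⇒> k≰i))) kx≤1) (<⇒≱ 1<ix)

  -- Type `j ≤ 11` has potential `1/j` on weight above `1/(j+1)`, a density below `(j+1)/j`, which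
  -- decreases in `j`. The numerical hypothesis says that the density `12/11` of the last type is
  -- within `(k+2)/(k+1)` too.
  harmonicPotential-ratio : ∀ k {x} → suc k ℕ.* 30240 ℕ.≤ suc (suc k) ℕ.* 27720 →
    0# ≤ x → x ≤ 1# → suc k · x ≤ 1# →
    suc k · harmonicPotential x ≤ (suc (suc k) ℕ.* 27720) · x
  harmonicPotential-ratio k {x} k≤ 0≤x x≤1 kx≤1 with harmonicPotential-cases x≤1
  ... | inj₁ (i , q , eq , 1<ix , φ≡) = begin
    suc k · harmonicPotential x                ≡⟨ ≡.cong (suc k ·_) φ≡ ⟩
    suc k · (q · 1#)                           ≤⟨ ·-monoʳ-≤ (suc k) (·-monoʳ-≤ q (proj₁ 1<ix)) ⟩
    suc k · (q · (suc (suc i) · x))            ≈⟨ ·-congˡ (suc k) (·-assoc x q (suc (suc i))) ⟩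
    suc k · ((q ℕ.* suc (suc i)) · x)          ≈⟨ ·-assoc x (suc k) _ ⟩
    (suc k ℕ.* (q ℕ.* suc (suc i))) · x        ≤⟨ ·-monoˡ-≤ 0≤x
                                                    (ratio-monotone q (s≤s (interval-monotone i k 0≤x 1<ix kx≤1))) ⟩
    (suc (suc k) ℕ.* (suc i ℕ.* q)) · x        ≡⟨ ≡.cong (λ d → (suc (suc k) ℕ.* d) · x) eq ⟩
    (suc (suc k) ℕ.* 27720) · x                ∎
  ... | inj₂ (_ , φ≡) = begin
    suc k · harmonicPotential x      ≡⟨ ≡.cong (suc k ·_) φ≡ ⟩
    suc k · (30240 · x)              ≈⟨ ·-assoc x (suc k) 30240 ⟩
    (suc k ℕ.* 30240) · x            ≤⟨ ·-monoˡ-≤ 0≤x k≤ ⟩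
    (suc (suc k) ℕ.* 27720) · x      ∎

  -- Weight at most `1/(k+1)` means type at least `k+1`. The last type reaches
  -- `12/11 · 1/12 = 1/11`, hence the limit 11.
  harmonicPotential-bounded : ∀ k {x} → suc k ℕ.≤ 11 → 0# ≤ x → x ≤ 1# → suc k · x ≤ 1# →
    suc k · harmonicPotential x ≤ 27720 · 1#
  harmonicPotential-bounded k {x} k<11 0≤x x≤1 kx≤1 with harmonicPotential-cases x≤1
  ... | inj₁ (i , q , eq , 1<ix , φ≡) = begin
    suc k · harmonicPotential x    ≡⟨ ≡.cong (suc k ·_) φ≡ ⟩
    suc k · (q · 1#)               ≈⟨ ·-assoc 1# (suc k) q ⟩
    (suc k ℕ.* q) · 1#             ≤⟨ ·-monoˡ-≤ 0≤1
                                        (ℕ.*-monoˡ-≤ q (s≤s (interval-monotone i k 0≤x 1<ix kx≤1))) ⟩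
    (suc i ℕ.* q) · 1#             ≡⟨ ≡.cong (_· 1#) eq ⟩
    27720 · 1#                     ∎
  ... | inj₂ (12x≤1 , φ≡) = begin
    suc k · harmonicPotential x    ≡⟨ ≡.cong (suc k ·_) φ≡ ⟩
    suc k · (30240 · x)            ≤⟨ ·-monoˡ-≤ (·-nonNegative 30240 0≤x) k<11 ⟩
    11 · (30240 · x)               ≈⟨ ·-assoc x 11 30240 ⟩
    332640 · x                     ≈⟨ ·-assoc x 27720 12 ⟨
    27720 · (12 · x)               ≤⟨ ·-monoʳ-≤ 27720 12x≤1 ⟩
    27720 · 1#                     ∎

  scaled-bound : ∀ k q p r {x y} → suc k · x ≤ p · y → suc q · y ≤ 1# →
                 p ℕ.≤ suc q ℕ.* suc k ℕ.* r → x ≤ r · 1#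
  scaled-bound k q p r {x} {y} kx≤py qy≤1 p≤ = ·-cancelˡ-≤ k (·-cancelˡ-≤ q (begin
    suc q · (suc k · x)                ≤⟨ ·-monoʳ-≤ (suc q) kx≤py ⟩
    suc q · (p · y)                    ≈⟨ ·-assoc y (suc q) p ⟩
    (suc q ℕ.* p) · y                  ≡⟨ ≡.cong (_· y) (ℕ.*-comm (suc q) p) ⟩
    (p ℕ.* suc q) · y                  ≈⟨ ·-assoc y p (suc q) ⟨
    p · (suc q · y)                    ≤⟨ ·-monoʳ-≤ p qy≤1 ⟩
    p · 1#                             ≤⟨ ·-monoˡ-≤ 0≤1 p≤ ⟩
    (suc q ℕ.* suc k ℕ.* r) · 1#       ≡⟨ ≡.cong (_· 1#) (ℕ.*-assoc (suc q) (suc k) r) ⟩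
    (suc q ℕ.* (suc k ℕ.* r)) · 1#     ≈⟨ ·-assoc 1# (suc q) (suc k ℕ.* r) ⟨
    suc q · ((suc k ℕ.* r) · 1#)       ≈⟨ ·-congˡ (suc q) (·-assoc 1# (suc k) r) ⟨
    suc q · (suc k · (r · 1#))         ∎))

  -- The identity `1/q - 1/(q+1) = 1/(q(q+1))`. Iterating `q ↦ q(q+1)` from 1 yields 2, 6, 42, the
  -- Sylvester pattern behind the extremal bin.
  residual : ∀ q {x y} → q · (x + y) ≤ 1# → 1# ≤ suc q · x → (suc q ℕ.* q) · y ≤ 1#
  residual q {x} {y} total≤1 1≤x = +-cancelˡ-≤ (q · 1#) (begin
    q · 1# + (suc q ℕ.* q) · y               ≤⟨ +-monoˡ-≤ _ (·-monoʳ-≤ q 1≤x) ⟩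
    q · (suc q · x) + (suc q ℕ.* q) · y      ≈⟨ +-congʳ (·-assoc x q (suc q)) ⟩
    (q ℕ.* suc q) · x + (suc q ℕ.* q) · y    ≡⟨ ≡.cong (λ k → k · x + (suc q ℕ.* q) · y) (ℕ.*-comm q (suc q)) ⟩
    (suc q ℕ.* q) · x + (suc q ℕ.* q) · y    ≈⟨ ·-distribˡ (suc q ℕ.* q) x y ⟨
    (suc q ℕ.* q) · (x + y)                  ≈⟨ ·-assoc (x + y) (suc q) q ⟨
    suc q · (q · (x + y))                    ≤⟨ ·-monoʳ-≤ (suc q) total≤1 ⟩
    suc q · 1#                               ≈⟨ suc· q 1# ⟩
    1# + q · 1#                              ≈⟨ +-comm 1# (q · 1#) ⟩
    q · 1# + 1#                              ∎)

  module _ {n : ℕ} where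

    potential : Edge n → Carrier
    potential = harmonicPotential ∘ weight

    potential-nonNegative : ∀ (e : Edge n) → 0# ≤ potential e
    potential-nonNegative e = harmonicPotential-nonNegative (0≤weight e)

    weight≤totalWeight : ∀ (es : List (Edge n)) → All (λ e → weight e ≤ totalWeight es) es
    weight≤totalWeight []       = []
    weight≤totalWeight (e ∷ es) =
      x≤x+y (∑-nonNegative 0≤weight es) ∷
      All.map (λ h → ≤-trans h (x≤y+x (0≤weight e))) (weight≤totalWeight es)

    weight-small : ∀ q (es : List (Edge n)) → q · totalWeight es ≤ 1# → All (λ e → q · weight e ≤ 1#) es
    weight-small q es total≤1 =
      All.map (λ h → ≤-trans (·-monoʳ-≤ q h) total≤1) (weight≤totalWeight es)

    -- Density at most `(k+2)/(k+1)` times total weight at most `1/(q+1)`.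
    small-items : ∀ k q r (es : List (Edge n)) → All (λ e → suc k · weight e ≤ 1#) es →
      suc q · totalWeight es ≤ 1# → suc k ℕ.* 30240 ℕ.≤ suc (suc k) ℕ.* 27720 →
      suc (suc k) ℕ.* 27720 ℕ.≤ suc q ℕ.* suc k ℕ.* r → ∑ potential es ≤ r · 1#
    small-items k q r es small total≤1 k≤ r≥ = scaled-bound k q _ r
      (∑-scaled potential weight (suc k) _ {es} (All.map
        (λ {e} → harmonicPotential-ratio k k≤ (0≤weight e) (weight≤1 e)) small))
      total≤1 r≥

    one-item : ∀ k r (e : Edge n) → suc k ℕ.≤ 11 → suc k · weight e ≤ 1# → 27720 ℕ.≤ 1 ℕ.* suc k ℕ.* r →
               potential e ≤ r · 1#
    one-item k r e k<11 small r≥ = scaled-bound k 0 27720 r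
      (harmonicPotential-bounded k k<11 (0≤weight e) (weight≤1 e) small)
      (≤-reflexive (1·x 1#)) r≥

    peel : ∀ q (es : List (Edge n)) → q · totalWeight es ≤ 1# →
      All (λ e → suc q · weight e ≤ 1#) es
      ⊎ ∃₂ λ e es′ → e ∷ es′ ↭ es × q · weight e ≤ 1# × (suc q ℕ.* q) · totalWeight es′ ≤ 1#
    peel q es total≤1 with partitionOne (λ e → 1# <? (suc q · weight e)) es
    ... | inj₁ none = inj₁ (All.map ≮⇒≥ none)
    ... | inj₂ (e , es′ , large , p) =
      inj₂ (e , es′ , p , All.head (weight-small q (e ∷ es′) total′≤1) , residual q total′≤1 (proj₁ large))
      where
      total′≤1 : q · totalWeight (e ∷ es′) ≤ 1#
      total′≤1 = ≤-respˡ-≈ (·-congˡ q (∑-↭ weight (↭-sym p))) total≤1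

    ∑-potential-∷ : ∀ p q e es′ (es : List (Edge n)) → e ∷ es′ ↭ es → potential e ≤ p · 1# →
                    ∑ potential es′ ≤ q · 1# → ∑ potential es ≤ (p ℕ.+ q) · 1#
    ∑-potential-∷ p q e es′ es perm φe≤ ∑≤ = begin
      ∑ potential es                  ≈⟨ ∑-↭ potential perm ⟨
      potential e + ∑ potential es′   ≤⟨ +-mono-≤ φe≤ ∑≤ ⟩
      p · 1# + q · 1#                 ≈⟨ ·-distribʳ 1# p q ⟨
      (p ℕ.+ q) · 1#                  ∎

    -- Peel off an item above 1/2, then one above 1/3, then one above 1/7; what
    -- is left has total weight at most 1/1, 1/2, 1/6 and 1/42 respectively.
    -- The extremal case gives 27720 (1 + 1/2 + 1/6 + 12/11 · 1/42) = 46920.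
    unitBin-potential : ∀ (es : List (Edge n)) → totalWeight es ≤ 1# → ∑ potential es ≤ 46920 · 1#
    unitBin-potential es total≤1
      with peel 1 es (≤-respˡ-≈ (sym (1·x _)) total≤1)
    -- Stopping early stays within budget: densities `3/2`, `4/3`, `8/7` on total weights `1`,
    -- `1/2`, `1/6` give 41580, 18480, 5280 against 46920, 19200, 5340.
    ... | inj₁ small = small-items 1 0 46920 es small (≤-respˡ-≈ (sym (1·x _)) total≤1)
                         (ℕ.≤ᵇ⇒≤ _ _ _) (ℕ.≤ᵇ⇒≤ _ _ _)
    ... | inj₂ (e₁ , es₁ , p₁ , w₁ , total₁) =
      ∑-potential-∷ 27720 19200 e₁ es₁ es p₁ (one-item 0 27720 e₁ (ℕ.≤ᵇ⇒≤ _ _ _) w₁ (ℕ.≤ᵇ⇒≤ _ _ _)) below½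
      where
      below½ : ∑ potential es₁ ≤ 19200 · 1#
      below½ with peel 2 es₁ total₁
      ... | inj₁ small = small-items 2 1 19200 es₁ small total₁ (ℕ.≤ᵇ⇒≤ _ _ _) (ℕ.≤ᵇ⇒≤ _ _ _)
      ... | inj₂ (e₂ , es₂ , p₂ , w₂ , total₂) =
        ∑-potential-∷ 13860 5340 e₂ es₂ es₁ p₂ (one-item 1 13860 e₂ (ℕ.≤ᵇ⇒≤ _ _ _) w₂ (ℕ.≤ᵇ⇒≤ _ _ _)) below⅙
        where
        below⅙ : ∑ potential es₂ ≤ 5340 · 1#
        below⅙ with peel 6 es₂ total₂
        ... | inj₁ small = small-items 6 5 5340 es₂ small total₂ (ℕ.≤ᵇ⇒≤ _ _ _) (ℕ.≤ᵇ⇒≤ _ _ _)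
        ... | inj₂ (e₃ , es₃ , p₃ , w₃ , total₃) =
          ∑-potential-∷ 4620 720 e₃ es₃ es₂ p₃ (one-item 5 4620 e₃ (ℕ.≤ᵇ⇒≤ _ _ _) w₃ (ℕ.≤ᵇ⇒≤ _ _ _))
            -- Without slack: `27720 · 12/11 · 1/42 = 720`.
            (small-items 10 41 720 es₃ tiny total₃ (ℕ.≤ᵇ⇒≤ _ _ _) (ℕ.≤ᵇ⇒≤ _ _ _))
          where
          tiny : All (λ e → 11 · weight e ≤ 1#) es₃
          tiny = All.map (λ {e} → ≤-trans (·-monoˡ-≤ (0≤weight e) (ℕ.≤ᵇ⇒≤ 11 42 _)))
                         (weight-small 42 es₃ total₃)

    sameType⇒sameInterval : ∀ {e e′ : Edge n} → harmonicType (weight e′) ≡ harmonicType (weight e) →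
                            interval (weight e′) ≡ interval (weight e)
    sameType⇒sameInterval {e} {e′} eq = toType-injective
      (≡.trans (≡.sym (harmonicType≡ (weight e′))) (≡.trans eq (harmonicType≡ (weight e))))

    -- For type `i ≤ 11`, any `i` items fit together, so an overfull bin already holds `i` of them,
    -- worth `1/i` each. For the last type `e` weighs at most `1/12`, so the bin holds at least
    -- `11/12`, worth `12/11` per unit of weight.
    overflow-potential : ∀ (e : Edge n) bin →
      All (λ e′ → harmonicType (weight e′) ≡ harmonicType (weight e)) bin →
      ¬ totalWeight (e ∷ bin) ≤ 1# →
      27720 · 1# ≤ ∑ potential bin
    overflow-potential e bin sameType overfull
      with interval (weight e) in eq | All.map (λ {e′} → sameType⇒sameInterval {e} {e′}) sameType
    ... | just i  | sameInterval = begin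
      27720 · 1#                    ≡⟨ ≡.cong (_· 1#) (quotient-exact i) ⟨
      (suc (toℕ i) ℕ.* q) · 1#      ≤⟨ ·-monoˡ-≤ 0≤1 (ℕ.*-monoˡ-≤ q full) ⟩
      (length bin ℕ.* q) · 1#       ≈⟨ ·-assoc 1# (length bin) q ⟨
      length bin · (q · 1#)         ≈⟨ ∑-replicated (All.map (λ {e′} → potential≡ {e′}) sameInterval) ⟨
      ∑ potential bin               ∎
      where
      q : ℕ
      q = 27720 / suc (toℕ i)

      potential≡ : ∀ {e′} → interval (weight e′) ≡ just i → potential e′ ≡ q · 1#
      potential≡ eq′ = ≡.cong (maybe _ _) eq′

      small : ∀ {e′} → interval (weight e′) ≡ just i → suc (toℕ i) · weight e′ ≤ 1 · 1#
      small {e′} eq′ = ≤-respʳ-≈ (sym (1·x 1#))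
        (≤1/suc⇒ (toℕ i) (proj₂ (interval-just eq′)))

      full : suc (toℕ i) ℕ.≤ length bin
      full = ℕ.≮⇒≥ λ length<suc-i → overfull (·-cancelˡ-≤ (toℕ i) (begin
        suc (toℕ i) · totalWeight (e ∷ bin)    ≤⟨ ∑-scaled weight (λ _ → 1#) (suc (toℕ i)) 1 {e ∷ bin}
                                                    (small {e} eq ∷ All.map (λ {e′} → small {e′}) sameInterval) ⟩
        1 · ∑ (λ _ → 1#) (e ∷ bin)             ≈⟨ 1·x _ ⟩
        ∑ (λ _ → 1#) (e ∷ bin)                 ≈⟨ ∑-replicated (All.universal (λ _ → ≡.refl) (e ∷ bin)) ⟩
        suc (length bin) · 1#                  ≤⟨ ·-monoˡ-≤ 0≤1 length<suc-i ⟩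
        suc (toℕ i) · 1#                       ∎))
    ... | nothing | sameInterval = begin
      -- The common factor is 2520: `27720 = 2520 · 11` and `30240 = 2520 · 12`.
      27720 · 1#               ≈⟨ ·-assoc 1# 2520 11 ⟨
      2520 · (11 · 1#)         ≤⟨ ·-monoʳ-≤ 2520 full ⟩
      2520 · (12 · B)          ≈⟨ ·-assoc B 2520 12 ⟩
      30240 · B                ≤⟨ ∑-scaled weight potential 30240 1 (All.map (λ {e′} → potential≥ {e′}) sameInterval) ⟩
      1 · ∑ potential bin      ≈⟨ 1·x _ ⟩
      ∑ potential bin          ∎
      where
      B : Carrier
      B = totalWeight bin

      potential≥ : ∀ {e′} → interval (weight e′) ≡ nothing → 30240 · weight e′ ≤ 1 · potential e′
      potential≥ {e′} eq′ = ≤-reflexive (begin-equality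
        30240 · weight e′   ≡⟨ ≡.cong (maybe _ _) eq′ ⟨
        potential e′        ≈⟨ 1·x _ ⟨
        1 · potential e′    ∎)

      small : 12 · weight e ≤ 1#
      small = outside⇒small (weight≤1 e) (interval-nothing eq)

      full : 11 · 1# ≤ 12 · B
      full = +-cancelˡ-≤ 1# (begin
        1# + 11 · 1#                 ≈⟨ suc· 11 1# ⟨
        12 · 1#                      ≤⟨ ·-monoʳ-≤ 12 (proj₁ (≰⇒> overfull)) ⟩
        12 · (weight e + B)          ≈⟨ ·-distribˡ 12 (weight e) B ⟩
        12 · weight e + 12 · B       ≤⟨ +-monoˡ-≤ (12 · B) small ⟩
        1# + 12 · B                  ∎)

-- From unit bins to palette sizes

module _ {c ℓ₁ ℓ₂} (F : OrderedField c ℓ₁ ℓ₂) (G : WeightedColoring.Multigraph F) where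

  open OrderedField F
  open OrderedFieldProperties F
  open WeightedColoring F
  open VertexSum F (order G)
  open import Relation.Binary.Reasoning.PartialOrder poset

  packing-∑-≤ : ∀ (f : Edge (order G) → Carrier) {y} →
                (∀ bin → totalWeight bin ≤ 1# → ∑ f bin ≤ y) →
                ∀ {es k} → Packing es k → ∑ f es ≤ k · y
  packing-∑-≤ f {y} bounded {es} {k} (bins , perm , fits) = begin
    ∑ f es                       ≈⟨ ∑-↭ f perm ⟨
    ∑ f (concat (toList bins))   ≤⟨ go bins fits ⟩
    k · y                        ∎
    where
    go : ∀ {j} (bins : Vec (List (Edge (order G))) j) → Vec.All (λ bin → totalWeight bin ≤ 1#) bins →
         ∑ f (concat (toList bins)) ≤ j · y
    go []           Vec.[]       = ≤-reflexive (sym (0·x y))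
    go {suc j} (bin ∷ bins) (h Vec.∷ hs) = begin
      ∑ f (bin ++ concat (toList bins))        ≈⟨ ∑-++ f bin (concat (toList bins)) ⟩
      ∑ f bin + ∑ f (concat (toList bins))     ≤⟨ +-mono-≤ (bounded bin h) (go bins hs) ⟩
      y + j · y                                ≈⟨ suc· j y ⟨
      suc j · y                                ∎

  vertexSum-≤ : ∀ {m} → IsMaxMinBins G m → ∀ (f : Edge (order G) → Carrier) {y} → 0# ≤ y →
                (∀ bin → totalWeight bin ≤ 1# → ∑ f bin ≤ y) →
                ∀ x → vertexSum f x (edges G) ≤ m · y
  vertexSum-≤ (bins , minimal , ≡.refl) f {y} 0≤y bounded x = begin
    vertexSum f x (edges G)   ≤⟨ packing-∑-≤ f bounded (proj₁ (minimal x)) ⟩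
    bins x · y                ≤⟨ ·-monoˡ-≤ 0≤y (≤-maximum bins x) ⟩
    maximum bins · y          ∎

  affordable⇒≤ : ∀ p d m k {z} → p · (d · 1#) ≤ z → z ≤ m · (k · 1#) → p ℕ.* d ℕ.≤ m ℕ.* k
  affordable⇒≤ p d m k {z} p≤ ≤m = ·1-cancel-≤ (begin
    (p ℕ.* d) · 1#    ≈⟨ ·-assoc 1# p d ⟨
    p · (d · 1#)      ≤⟨ p≤ ⟩
    z                 ≤⟨ ≤m ⟩
    m · (k · 1#)      ≈⟨ ·-assoc 1# m k ⟩
    (m ℕ.* k) · 1#    ∎)

  nextFit-succeeds : ∀ {m} → IsMaxMinBins G m → ∀ N → 4 ℕ.* m ℕ.+ 2 ℕ.* maxNeighbors G ℕ.≤ N →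
                     ∀ arrivals → arrivals ↭ edges G → NextFit.Succeeds (order G) N arrivals
  -- The unit is written `1 · 1#` so that `affordable⇒≤` applies with `d = 1`.
  nextFit-succeeds {m} isMax N enough = Amortized.succeeds F G (λ _ → Fin.zero {0}) N (1 · 1#) φ weight 0≤weight
    (λ e → weight≤φ e) overflow (4 ℕ.* m) closed-bound
    (≡.subst (λ t → 4 ℕ.* m ℕ.+ 2 ℕ.* t ℕ.≤ N) (≡.sym (ℕ.*-identityˡ (maxNeighbors G))) enough)
    where
    φ : Edge (order G) → Carrier
    φ e = 2 · weight e

    φ≈ : ∀ e → φ e ≈ weight e + weight e
    φ≈ e = begin-equality
      2 · weight e              ≈⟨ suc· 1 (weight e) ⟩
      weight e + 1 · weight e   ≈⟨ +-congˡ (1·x (weight e)) ⟩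
      weight e + weight e       ∎

    weight≤φ : ∀ e → weight e ≤ φ e
    weight≤φ e = ≤-respʳ-≈ (sym (φ≈ e)) (x≤x+y (0≤weight e))

    overflow : ∀ e bin → All (λ _ → Fin.zero {0} ≡ Fin.zero) bin → ¬ totalWeight (e ∷ bin) ≤ 1# →
               1 · 1# + weight e ≤ totalWeight bin + φ e
    overflow e bin _ overfull = begin
      1 · 1# + weight e                        ≈⟨ +-congʳ (1·x 1#) ⟩
      1# + weight e                            ≤⟨ +-monoˡ-≤ (weight e) (proj₁ (≰⇒> overfull)) ⟩
      weight e + totalWeight bin + weight e    ≈⟨ +-congʳ (+-comm (weight e) (totalWeight bin)) ⟩
      totalWeight bin + weight e + weight e    ≈⟨ +-assoc (totalWeight bin) (weight e) (weight e) ⟩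
      totalWeight bin + (weight e + weight e)  ≈⟨ +-congˡ (φ≈ e) ⟨
      totalWeight bin + φ e                    ∎

    φ-bounded : ∀ bin → totalWeight bin ≤ 1# → ∑ φ bin ≤ 2 · 1#
    φ-bounded bin fits = begin
      ∑ φ bin                 ≈⟨ 1·x (∑ φ bin) ⟨
      1 · ∑ φ bin             ≤⟨ ∑-scaled φ weight 1 2 {bin} (All.universal (λ e → ≤-reflexive (1·x (φ e))) bin) ⟩
      2 · totalWeight bin     ≤⟨ ·-monoʳ-≤ 2 fits ⟩
      2 · 1#                  ∎

    closed≤ : ∀ x p → p · (1 · 1#) ≤ vertexSum φ x (edges G) → p ℕ.≤ 2 ℕ.* m
    closed≤ x p h = ≡.subst₂ ℕ._≤_ (ℕ.*-identityʳ p) (ℕ.*-comm m 2)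
      (affordable⇒≤ p 1 m 2 h (vertexSum-≤ isMax φ (·-nonNegative 2 0≤1) φ-bounded x))

    closed-bound : ∀ x y p q → p · (1 · 1#) ≤ vertexSum φ x (edges G) →
                   q · (1 · 1#) ≤ vertexSum φ y (edges G) → p ℕ.+ q ℕ.≤ 4 ℕ.* m
    closed-bound x y p q hp hq = ≡.subst (p ℕ.+ q ℕ.≤_) (≡.sym (ℕ.*-distribʳ-+ m 2 2))
      (ℕ.+-mono-≤ (closed≤ x p hp) (closed≤ y q hq))

  -- A palette has a whole number of colors, so `1.693 · 2m` enters through its floor.
  harmonic-succeeds : ∀ {m} → IsMaxMinBins G m →
                      ∀ N → (1693 ℕ.* (2 ℕ.* m)) / 1000 ℕ.+ 24 ℕ.* maxNeighbors G ℕ.≤ N →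
                      ∀ arrivals → arrivals ↭ edges G → Harmonic₁₂.Succeeds (order G) N arrivals
  harmonic-succeeds {m} isMax N enough = Amortized.succeeds F G harmonicType N (27720 · 1#) potential potential
    potential-nonNegative (λ _ → ≤-refl)
    (λ e bin sameType overfull → +-monoˡ-≤ (potential e) (overflow-potential e bin sameType overfull))
    ((1693 ℕ.* (2 ℕ.* m)) / 1000) closed-bound
    (≡.subst (λ t → (1693 ℕ.* (2 ℕ.* m)) / 1000 ℕ.+ t ℕ.≤ N) (ℕ.*-assoc 2 12 (maxNeighbors G)) enough)
    where
    open Harmonic F

    closed-bound : ∀ x y p q → p · (27720 · 1#) ≤ vertexSum potential x (edges G) →
                   q · (27720 · 1#) ≤ vertexSum potential y (edges G) →
                   p ℕ.+ q ℕ.≤ (1693 ℕ.* (2 ℕ.* m)) / 1000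
    -- The numerical check is `46920/27720 = 1.69264… ≤ 1.693`.
    closed-bound x y p q hp hq = sum-≤-quotient 1693 1000 27720 46920 p q m (ℕ.≤ᵇ⇒≤ _ _ _)
      (affordable⇒≤ p 27720 m 46920 hp (∑≤ x)) (affordable⇒≤ q 27720 m 46920 hq (∑≤ y))
      where
      ∑≤ : ∀ z → vertexSum potential z (edges G) ≤ m · (46920 · 1#)
      ∑≤ = vertexSum-≤ isMax potential (·-nonNegative 46920 0≤1) unitBin-potential

open import Data.Nat.Base using (ℕ; _+_; _*_; _/_; _≤_)

theorem8 : ∀ {c ℓ₁ ℓ₂} (F : OrderedField c ℓ₁ ℓ₂) → let open WeightedColoring F in
    (G : Multigraph) (arrivals : List (Edge (order G))) → arrivals ↭ edges G →
    (m : ℕ) → IsMaxMinBins G m →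
    let t = maxNeighbors G in
    (∀ N → (1693 * (2 * m)) / 1000 + 24 * t ≤ N → Harmonic₁₂.Succeeds (order G) N arrivals)
    × (∀ N → 4 * m + 2 * t ≤ N → NextFit.Succeeds (order G) N arrivals)
theorem8 F G arrivals perm m isMax =
  (λ N enough → harmonic-succeeds F G isMax N enough arrivals perm) ,
  (λ N enough → nextFit-succeeds F G isMax N enough arrivals perm)
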